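{- For all integers $t\ge1$ and $d\ge0$ there exist $n_0$ and a constant $K$ (both depending only on $t$ and $d$) such that the following holds for all $n\ge n_0$. If $\mathcal F\subseteq S_n$ is a $t$-intersecting family whose characteristic function $f\colon S_n\to\{0,1\}$ satisfies $\deg f\le d$, then either $\mathcal F$ is contained in a $t$-star, or $|\mathcal F|\le K\,(n-t-1)!$.
   Context: A family $\mathcal F\subseteq S_n$ is $t$-intersecting if for any two $\pi_1,\pi_2\in\mathcal F$ there are at least $t$ points $i\in[n]$ with $\pi_1(i)=\pi_2(i)$. A $t$-star is a family of the form $\{\pi\in S_n:\pi(i_1)=j_1,\dots,\pi(i_t)=j_t\}$, where $i_1,\dots,i_t$ are distinct and $j_1,\dots,j_t$ are distinct. For $\pi\in S_n$ let $x_{i,j}=1$ if $\pi(i)=j$ and $x_{i,j}=0$ otherwise. The degree $\deg f$ of $f\colon S_n\to\mathbb R$ is the minimum degree of a real polynomial in the variables $x_{i,j}$ that agrees with $f$ on $S_n$. -}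

module Defs where

open import Data.Bool.Base using (Bool; if_then_else_)
open import Data.Fin.Base using (Fin)
import Data.Fin.Properties as Fin
open import Data.Fin.Permutation using (Permutation′; _⟨$⟩ʳ_; _≈_)
open import Data.List.Base using (List; []; _∷_; length; filter; foldr; map; allFin)
open import Data.List.Relation.Unary.All using (All)
import Data.List.Membership.DecSetoid as Membership
import Data.List.Relation.Unary.Unique.DecSetoid as Uniqueness
open import Data.Nat.Base as ℕ using (ℕ)
import Data.Nat.Properties as ℕ
open import Data.Product.Base using (_×_; _,_; proj₁; proj₂; Σ-syntax; ∃-syntax)
open import Data.Rational.Base as ℚ using (ℚ; 0ℚ; 1ℚ; ½; ∣_∣; Positive)
import Data.Rational.Properties as ℚ
open import Data.Rational.Solver using (module +-*-Solver)
open import Function.Bundles using (_↣_; Injection)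
open import Level using (0ℓ)
open import Relation.Binary.Bundles using (DecSetoid)
open import Relation.Binary.PropositionalEquality
  using (_≡_; refl; sym; trans; cong; cong₂; subst)
open import Relation.Nullary.Decidable using (does)
open import Relation.Unary using (Pred)

-- Real numbers: Cauchy sequences of rationals, with equality up to null
-- sequences and pointwise arithmetic.

Cauchy : (ℕ → ℚ) → Set
Cauchy x = ∀ ε → .{{Positive ε}} →
  ∃[ N ] (∀ m n → N ℕ.≤ m → N ℕ.≤ n → ∣ x m ℚ.- x n ∣ ℚ.≤ ε)

record ℝ : Set where
  constructor mkℝ
  field
    seq    : ℕ → ℚ
    cauchy : Cauchy seq

open ℝ public

infix 4 _≃_

_≃_ : ℝ → ℝ → Set
x ≃ y = ∀ ε → .{{Positive ε}} →
  ∃[ N ] (∀ n → N ℕ.≤ n → ∣ seq x n ℚ.- seq y n ∣ ℚ.≤ ε)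

half+half : ∀ ε → ½ ℚ.* ε ℚ.+ ½ ℚ.* ε ≡ ε
half+half ε = trans (sym (ℚ.*-distribʳ-+ ε ½ ½)) (ℚ.*-identityˡ ε)

constant-cauchy : ∀ q → Cauchy (λ _ → q)
constant-cauchy q ε = 0 , λ _ _ _ _ →
  subst (λ z → ∣ z ∣ ℚ.≤ ε) (sym (ℚ.+-inverseʳ q))
    (ℚ.<⇒≤ (ℚ.positive⁻¹ ε))

+-cauchy : ∀ {x y} → Cauchy x → Cauchy y → Cauchy (λ n → x n ℚ.+ y n)
+-cauchy {x} {y} cx cy ε = N ℕ.⊔ M , bound
  where
  instance
    half-pos : Positive (½ ℚ.* ε)
    half-pos = ℚ.pos*pos⇒pos ½ ε

  N = proj₁ (cx (½ ℚ.* ε))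
  M = proj₁ (cy (½ ℚ.* ε))

  rearrange : ∀ a b c d →
    (a ℚ.+ b) ℚ.- (c ℚ.+ d) ≡ (a ℚ.- c) ℚ.+ (b ℚ.- d)
  rearrange = solve 4 (λ a b c d →
    (a :+ b) :- (c :+ d) := (a :- c) :+ (b :- d)) refl
    where open +-*-Solver

  bound : ∀ m n → N ℕ.⊔ M ℕ.≤ m → N ℕ.⊔ M ℕ.≤ n →
          ∣ (x m ℚ.+ y m) ℚ.- (x n ℚ.+ y n) ∣ ℚ.≤ ε
  bound m n p q = begin
    ∣ (x m ℚ.+ y m) ℚ.- (x n ℚ.+ y n) ∣
      ≡⟨ cong ∣_∣ (rearrange (x m) (y m) (x n) (y n)) ⟩
    ∣ (x m ℚ.- x n) ℚ.+ (y m ℚ.- y n) ∣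
      ≤⟨ ℚ.∣p+q∣≤∣p∣+∣q∣ (x m ℚ.- x n) (y m ℚ.- y n) ⟩
    ∣ x m ℚ.- x n ∣ ℚ.+ ∣ y m ℚ.- y n ∣
      ≤⟨ ℚ.+-mono-≤
           (proj₂ (cx (½ ℚ.* ε)) m n
             (ℕ.m⊔n≤o⇒m≤o N M p) (ℕ.m⊔n≤o⇒m≤o N M q))
           (proj₂ (cy (½ ℚ.* ε)) m n
             (ℕ.m⊔n≤o⇒n≤o N M p) (ℕ.m⊔n≤o⇒n≤o N M q)) ⟩
    ½ ℚ.* ε ℚ.+ ½ ℚ.* ε
      ≡⟨ half+half ε ⟩
    ε ∎
    where open ℚ.≤-Reasoning

eventually-bounded : ∀ {x} → Cauchy x →
  Σ[ B ∈ ℚ ] (Positive B × ∃[ N ] (∀ n → N ℕ.≤ n → ∣ x n ∣ ℚ.≤ B))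
eventually-bounded {x} cx = B , B-pos , N , bound
  where
  N = proj₁ (cx 1ℚ)
  B = 1ℚ ℚ.+ ∣ x N ∣

  B-pos : Positive B
  B-pos = ℚ.pos+nonNeg⇒pos 1ℚ ∣ x N ∣ {{ℚ.∣-∣-nonNeg (x N)}}

  rearrange : ∀ a b → a ≡ (a ℚ.- b) ℚ.+ b
  rearrange = solve 2 (λ a b → a := (a :- b) :+ b) refl
    where open +-*-Solver

  bound : ∀ n → N ℕ.≤ n → ∣ x n ∣ ℚ.≤ B
  bound n p = begin
    ∣ x n ∣                       ≡⟨ cong ∣_∣ (rearrange (x n) (x N)) ⟩
    ∣ (x n ℚ.- x N) ℚ.+ x N ∣     ≤⟨ ℚ.∣p+q∣≤∣p∣+∣q∣ (x n ℚ.- x N) (x N) ⟩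
    ∣ x n ℚ.- x N ∣ ℚ.+ ∣ x N ∣   ≤⟨ ℚ.+-monoˡ-≤ ∣ x N ∣
                                       (proj₂ (cx 1ℚ) n N p ℕ.≤-refl) ⟩
    B                             ∎
    where open ℚ.≤-Reasoning

∣∣*∣∣-mono : ∀ a b {A B} → ∣ a ∣ ℚ.≤ A → ∣ b ∣ ℚ.≤ B →
             ∣ a ℚ.* b ∣ ℚ.≤ A ℚ.* B
∣∣*∣∣-mono a b {A} {B} p q = begin
  ∣ a ℚ.* b ∣      ≡⟨ ℚ.∣p*q∣≡∣p∣*∣q∣ a b ⟩
  ∣ a ∣ ℚ.* ∣ b ∣  ≤⟨ ℚ.*-monoˡ-≤-nonNeg ∣ a ∣ {{ℚ.∣-∣-nonNeg a}} q ⟩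
  ∣ a ∣ ℚ.* B      ≤⟨ ℚ.*-monoʳ-≤-nonNeg B
                        {{ℚ.nonNegative (ℚ.≤-trans (ℚ.0≤∣p∣ b) q)}} p ⟩
  A ℚ.* B          ∎
  where open ℚ.≤-Reasoning

scale : ∀ C → Positive C → ∀ ε → Positive ε →
        Σ[ δ ∈ ℚ ] (Positive δ × C ℚ.* δ ≡ ε)
scale C C-pos ε ε-pos =
  C⁻¹ ℚ.* ε ,
  ℚ.pos*pos⇒pos C⁻¹ {{ℚ.1/pos⇒pos C {{C-pos}}}} ε {{ε-pos}} ,
  trans (sym (ℚ.*-assoc C C⁻¹ ε))
    (trans (cong (ℚ._* ε) (ℚ.*-inverseʳ C {{ℚ.pos⇒nonZero C {{C-pos}}}}))
      (ℚ.*-identityˡ ε))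
  where C⁻¹ = (ℚ.1/ C) {{ℚ.pos⇒nonZero C {{C-pos}}}}

product-difference : ∀ a b c d → a ℚ.* b ℚ.- c ℚ.* d ≡
                     a ℚ.* (b ℚ.- d) ℚ.+ d ℚ.* (a ℚ.- c)
product-difference = solve 4 (λ a b c d →
  a :* b :- c :* d := a :* (b :- d) :+ d :* (a :- c)) refl
  where open +-*-Solver

product-bound : ∀ a b c d {A B δ₁ δ₂ ε} →
  ∣ a ∣ ℚ.≤ A → ∣ b ℚ.- d ∣ ℚ.≤ δ₁ → A ℚ.* δ₁ ≡ ½ ℚ.* ε →
  ∣ d ∣ ℚ.≤ B → ∣ a ℚ.- c ∣ ℚ.≤ δ₂ → B ℚ.* δ₂ ≡ ½ ℚ.* ε →
  ∣ a ℚ.* b ℚ.- c ℚ.* d ∣ ℚ.≤ ε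
product-bound a b c d {A} {B} {δ₁} {δ₂} {ε} p q r p′ q′ r′ = begin
  ∣ a ℚ.* b ℚ.- c ℚ.* d ∣
    ≡⟨ cong ∣_∣ (product-difference a b c d) ⟩
  ∣ a ℚ.* (b ℚ.- d) ℚ.+ d ℚ.* (a ℚ.- c) ∣
    ≤⟨ ℚ.∣p+q∣≤∣p∣+∣q∣ (a ℚ.* (b ℚ.- d)) (d ℚ.* (a ℚ.- c)) ⟩
  ∣ a ℚ.* (b ℚ.- d) ∣ ℚ.+ ∣ d ℚ.* (a ℚ.- c) ∣
    ≤⟨ ℚ.+-mono-≤ (∣∣*∣∣-mono a (b ℚ.- d) p q)
                  (∣∣*∣∣-mono d (a ℚ.- c) p′ q′) ⟩
  A ℚ.* δ₁ ℚ.+ B ℚ.* δ₂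
    ≡⟨ cong₂ ℚ._+_ r r′ ⟩
  ½ ℚ.* ε ℚ.+ ½ ℚ.* ε
    ≡⟨ half+half ε ⟩
  ε ∎
  where open ℚ.≤-Reasoning

*-cauchy : ∀ {x y} → Cauchy x → Cauchy y → Cauchy (λ n → x n ℚ.* y n)
*-cauchy {x} {y} cx cy ε =
  let A , A-pos , N₁ , x≤A = eventually-bounded {x} cx
      B , B-pos , N₂ , y≤B = eventually-bounded {y} cy
      half-pos = ℚ.pos*pos⇒pos ½ ε
      δ₁ , δ₁-pos , Aδ₁ = scale A A-pos (½ ℚ.* ε) half-pos
      δ₂ , δ₂-pos , Bδ₂ = scale B B-pos (½ ℚ.* ε) half-pos
      N₃ , yδ = cy δ₁ {{δ₁-pos}}
      N₄ , xδ = cx δ₂ {{δ₂-pos}}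
      N₁₂ = N₁ ℕ.⊔ N₂
      N₃₄ = N₃ ℕ.⊔ N₄
  in N₁₂ ℕ.⊔ N₃₄ , λ m n p q →
    let p₁₂ = ℕ.m⊔n≤o⇒m≤o N₁₂ N₃₄ p
        p₃₄ = ℕ.m⊔n≤o⇒n≤o N₁₂ N₃₄ p
        q₁₂ = ℕ.m⊔n≤o⇒m≤o N₁₂ N₃₄ q
        q₃₄ = ℕ.m⊔n≤o⇒n≤o N₁₂ N₃₄ q
    in product-bound (x m) (y m) (x n) (y n)
         (x≤A m (ℕ.m⊔n≤o⇒m≤o N₁ N₂ p₁₂))
         (yδ m n (ℕ.m⊔n≤o⇒m≤o N₃ N₄ p₃₄) (ℕ.m⊔n≤o⇒m≤o N₃ N₄ q₃₄))
         Aδ₁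
         (y≤B n (ℕ.m⊔n≤o⇒n≤o N₁ N₂ q₁₂))
         (xδ m n (ℕ.m⊔n≤o⇒n≤o N₃ N₄ p₃₄) (ℕ.m⊔n≤o⇒n≤o N₃ N₄ q₃₄))
         Bδ₂

infixl 6 _+_
infixl 7 _*_

0ℝ 1ℝ : ℝ
0ℝ = mkℝ (λ _ → 0ℚ) (constant-cauchy 0ℚ)
1ℝ = mkℝ (λ _ → 1ℚ) (constant-cauchy 1ℚ)

_+_ _*_ : ℝ → ℝ → ℝ
x + y = mkℝ (λ n → seq x n ℚ.+ seq y n)
            (+-cauchy {seq x} {seq y} (cauchy x) (cauchy y))
x * y = mkℝ (λ n → seq x n ℚ.* seq y n)
            (*-cauchy {seq x} {seq y} (cauchy x) (cauchy y))

𝟙 : Bool → ℝ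
𝟙 b = if b then 1ℝ else 0ℝ

Monomial : ℕ → Set
Monomial n = List (Fin n × Fin n)

-- A finite sum of terms c · x i₁ j₁ ⋯ x iₖ jₖ; like terms need not be
-- collected.
Polynomial : ℕ → Set
Polynomial n = List (ℝ × Monomial n)

-- A polynomial has degree at most d precisely when some expression for it as
-- a sum of terms satisfies this.
Degree≤ : ∀ {n} → ℕ → Polynomial n → Set
Degree≤ d p = All (λ term → length (proj₂ term) ℕ.≤ d) p

x[_,_] : ∀ {n} → Fin n → Fin n → Permutation′ n → ℝ
x[ i , j ] π = 𝟙 (does (π ⟨$⟩ʳ i Fin.≟ j))

evalMonomial : ∀ {n} → Monomial n → Permutation′ n → ℝ
evalMonomial vars π =
  foldr _*_ 1ℝ (map (λ v → x[ proj₁ v , proj₂ v ] π) vars)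

eval : ∀ {n} → Polynomial n → Permutation′ n → ℝ
eval p π =
  foldr _+_ 0ℝ (map (λ term → proj₁ term * evalMonomial (proj₂ term) π) p)

-- The degree of f is the least degree of a polynomial agreeing with f, so it
-- is at most d exactly when some agreeing polynomial has degree at most d.
deg_≤_ : ∀ {n} → (Permutation′ n → ℝ) → ℕ → Set
deg_≤_ {n} f d =
  Σ[ p ∈ Polynomial n ] (Degree≤ d p × (∀ π → eval p π ≃ f π))

permutationDecSetoid : ℕ → DecSetoid 0ℓ 0ℓ
permutationDecSetoid n = record
  { Carrier = Permutation′ n
  ; _≈_ = _≈_
  ; isDecEquivalence = record
    { isEquivalence = record
      { refl  = λ _ → refl
      ; sym   = λ p i → sym (p i)
      ; trans = λ p q i → trans (p i) (q i)
      }
    ; _≟_ = λ π ρ → Fin.all? (λ i → π ⟨$⟩ʳ i Fin.≟ ρ ⟨$⟩ʳ i)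
    }
  }

module _ {n : ℕ} where
  open Membership (permutationDecSetoid n) public using (_∈_; _∈?_)
  open Uniqueness (permutationDecSetoid n) public using (Unique)

-- A finite subset of Sₙ, listed without repetition. Membership and uniqueness
-- are with respect to pointwise equality of permutations.
record Family (n : ℕ) : Set where
  field
    members : List (Permutation′ n)
    unique  : Unique members

open Family public

card : ∀ {n} → Family n → ℕ
card F = length (members F)

characteristic : ∀ {n} → Family n → Permutation′ n → ℝ
characteristic F π = 𝟙 (does (π ∈? members F))

agreements : ∀ {n} → Permutation′ n → Permutation′ n → List (Fin n)
agreements {n} π ρ = filter (λ i → π ⟨$⟩ʳ i Fin.≟ ρ ⟨$⟩ʳ i) (allFin n)

Intersecting : ∀ {n} → ℕ → Family n → Set
Intersecting t F = ∀ π ρ → π ∈ members F → ρ ∈ members F →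
  t ℕ.≤ length (agreements π ρ)

Star : ∀ {n t} → (i j : Fin t ↣ Fin n) → Pred (Permutation′ n) 0ℓ
Star i j π = ∀ k → π ⟨$⟩ʳ Injection.to i k ≡ Injection.to j k

ContainedInStar : ∀ {n} → ℕ → Family n → Set
ContainedInStar {n} t F =
  Σ[ i ∈ Fin t ↣ Fin n ] Σ[ j ∈ Fin t ↣ Fin n ]
    (∀ π → π ∈ members F → Star i j π)

{-# OPTIONS --safe #-}

-- A difference of order d + 1 along permutations with pairwise disjoint supports kills every monomial of
-- degree at most d, since one of the supports contains none of its positions.  An integer function h of
-- bounded oscillation whose d-th differences vanish can be sensitive at a point to boundedly many disjoint
-- σ only: for a product τ of some of them, the difference of h along τ has vanishing differences of order
-- d − 1, so by induction almost every further σ changes h as much after τ as before, and these changes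
-- add up.  Hence, as for Boolean functions on the cube, F has bounded certificates at each of its members:
-- take a maximal disjoint family of sensitive permutations with small supports.
-- Off its certificate a member may be altered so as to disagree with any given permutation, so two members
-- of F agree at t positions of the certificate of either.  If F lies in no t-star, each ρ in F extends the
-- restriction of a fixed π to some t positions T of its certificate, some σ in F disagrees with π on T, and
-- ρ agrees with σ at a position of the certificate of σ outside T.  This covers F by boundedly many
-- (t + 1)-stars.

module Submission where

open import Data.Bool.Base using (Bool; true; false; if_then_else_)
import Data.Bool.Properties as Bool
open import Data.Fin.Base using (Fin; zero; suc; finToFun; funToFin)
open import Data.Fin.Permutation
  using (Permutation′; _⟨$⟩ʳ_; _⟨$⟩ˡ_; _≈_; _∘ₚ_; id; flip; inverseˡ; inverseʳ; permutation; transpose)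
import Data.Fin.Properties as Fin
open import Data.Integer.Base as ℤ using (ℤ; +_; 0ℤ; 1ℤ)
import Data.Integer.Properties as ℤ
import Data.Integer.Solver as ℤSolver
open import Data.List.Base
  using (List; []; _∷_; _++_; length; filter; map; lookup; allFin; concatMap; deduplicate)
open import Data.List.Membership.Propositional using (_∈_; _∉_; find; lose)
open import Data.List.Membership.Propositional.Properties
  using (∈-∃++; ∈-allFin; ∈-++⁻; ∈-++⁺ˡ; ∈-++⁺ʳ; ∈-filter⁺; ∈-filter⁻; ∈-map⁺; ∈-lookup; ∈-deduplicate⁺)
open import Data.List.Properties
  using (length-++; length-++-sucʳ; length-map; length-tabulate; length-take; length-deduplicate; filter-all)
open import Data.List.Relation.Binary.Sublist.Propositional using (_⊆_; []; _∷_; _∷ʳ_; ⊆-trans)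
open import Data.List.Relation.Binary.Sublist.Propositional.Properties using (filter-⊆; take-⊆)
open import Data.List.Relation.Unary.All as All using (All; []; _∷_)
import Data.List.Relation.Unary.All.Properties as All
open import Data.List.Relation.Unary.AllPairs as AllPairs using (AllPairs; []; _∷_)
import Data.List.Relation.Unary.AllPairs.Properties as AllPairs
open import Data.List.Relation.Unary.Any as Any using (Any; here; there)
open import Data.List.Relation.Unary.Unique.DecPropositional.Properties using (deduplicate-!)
open import Data.List.Relation.Unary.Unique.Propositional using (Unique)
import Data.List.Relation.Unary.Unique.Propositional.Properties as Unique
open import Data.Nat.Base as ℕ using (ℕ; zero; suc; _≤_; _∸_; _*_; _!)
import Data.Nat.Properties as ℕ
open import Data.Product.Base using (_×_; _,_; proj₁; proj₂; Σ-syntax; ∃-syntax)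
open import Data.Rational.Base as ℚ using (ℚ; 0ℚ; ½; ∣_∣; Positive)
import Data.Rational.Properties as ℚ
import Data.Rational.Solver as ℚSolver
import Data.Rational.Unnormalised.Base as ℚᵘ
import Data.Rational.Unnormalised.Properties as ℚᵘ
open import Data.Sum.Base as Sum using (_⊎_; inj₁; inj₂)
open import Function.Base using (_∘_)
open import Function.Bundles using (mk↣; mk⇔)
open import Relation.Binary.PropositionalEquality
  using (_≡_; _≢_; refl; sym; trans; cong; cong₂; subst; subst₂)
open import Relation.Nullary.Decidable
  using (Dec; yes; no; does; ¬?; _×-dec_; decidable-stable; dec-true; dec-false; does-⇔)
open import Relation.Nullary.Negation using (¬_; contradiction)
open import Relation.Unary using (Pred; Decidable)
open import Defs
  using (seq; 𝟙; Monomial; Polynomial; Degree≤; evalMonomial; eval; deg_≤_; half+half; Family; members; unique;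
         card; characteristic; agreements; Intersecting; ContainedInStar; _∈?_)
  renaming (_∈_ to _∈ₚ_)

private variable
  n : ℕ

-- Splitting lists by a decidable property.

length-filter-split : ∀ {a p} {A : Set a} {P : Pred A p} (P? : Decidable P) xs →
  length xs ≡ length (filter P? xs) ℕ.+ length (filter (¬? ∘ P?) xs)
length-filter-split P? [] = refl
length-filter-split P? (x ∷ xs) with P? x
... | yes _ = cong suc (length-filter-split P? xs)
... | no _ = trans (cong suc (length-filter-split P? xs)) (sym (ℕ.+-suc _ _))

all-or-split : ∀ {a p} {A : Set a} {P : Pred A p} → Decidable P → ∀ zs →
  All P zs ⊎ Σ[ xs ∈ List A ] Σ[ y ∈ A ] Σ[ ys ∈ List A ]
    (zs ≡ xs ++ y ∷ ys × All P xs × ¬ P y)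
all-or-split P? [] = inj₁ []
all-or-split P? (z ∷ zs) with P? z
... | no ¬p = inj₂ ([] , z , zs , refl , [] , ¬p)
... | yes p with all-or-split P? zs
...   | inj₁ ps = inj₁ (p ∷ ps)
...   | inj₂ (xs , y , ys , refl , ps , ¬p) = inj₂ (z ∷ xs , y , ys , refl , p ∷ ps , ¬p)

AllPairs-++⁻ : ∀ {a r} {A : Set a} {R : A → A → Set r} xs {ys} →
  AllPairs R (xs ++ ys) → AllPairs R xs × AllPairs R ys
AllPairs-++⁻ [] rs = [] , rs
AllPairs-++⁻ (x ∷ xs) (r ∷ rs) =
  let ps , qs = AllPairs-++⁻ xs rs in All.++⁻ˡ xs r ∷ ps , qs

-- Permutations with disjoint supports

⟨$⟩ʳ-injective : (π : Permutation′ n) → ∀ {i j} → π ⟨$⟩ʳ i ≡ π ⟨$⟩ʳ j → i ≡ j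
⟨$⟩ʳ-injective π eq = trans (sym (inverseˡ π)) (trans (cong (π ⟨$⟩ˡ_) eq) (inverseˡ π))

Fixes : Permutation′ n → Fin n → Set
Fixes σ i = σ ⟨$⟩ʳ i ≡ i

fixes? : (σ : Permutation′ n) → Decidable (Fixes σ)
fixes? σ i = σ ⟨$⟩ʳ i Fin.≟ i

infix 4 _#_ _#*_

record _#_ (σ τ : Permutation′ n) : Set where
  constructor disjoint
  field
    fixes : ∀ i → Fixes σ i ⊎ Fixes τ i

open _#_

#-sym : {σ τ : Permutation′ n} → σ # τ → τ # σ
#-sym p .fixes i = Sum.swap (p .fixes i)

#-∘ₚ : {σ τ ρ : Permutation′ n} → σ # ρ → τ # ρ → σ ∘ₚ τ # ρ
#-∘ₚ {τ = τ} p q .fixes i with p .fixes i | q .fixes i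
... | inj₂ r | _ = inj₂ r
... | inj₁ _ | inj₂ r = inj₂ r
... | inj₁ r | inj₁ s = inj₁ (trans (cong (τ ⟨$⟩ʳ_) r) s)

id-# : {τ : Permutation′ n} → id # τ
id-# .fixes i = inj₁ refl

#-fixes : {σ τ : Permutation′ n} {i : Fin n} → σ # τ → ¬ Fixes σ i → Fixes τ i
#-fixes {i = i} p q with p .fixes i
... | inj₁ r = contradiction r q
... | inj₂ r = r

-- By disjointness each position is moved by at most one of the permutations. If the first moves a
-- listed position, all the others fix it, and it can be struck from the list.
untouched : ∀ (σs : List (Permutation′ n)) is → AllPairs _#_ σs →
            length is ℕ.< length σs → ∃[ ρ ] (ρ ∈ σs × All (Fixes ρ) is)
untouched (σ ∷ σs) is (p ∷ pw) lt with all-or-split (fixes? σ) is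
... | inj₁ fixed = σ , here refl , fixed
... | inj₂ (js , k , ks , refl , _ , ¬fixed) =
  let ρ , ρ∈ , q = untouched σs (js ++ ks) pw
        (ℕ.≤-trans (ℕ.≤-reflexive (sym (length-++-sucʳ js k ks))) (ℕ.s≤s⁻¹ lt))
  in ρ , there ρ∈ , All.++⁺ (All.++⁻ˡ js q) (#-fixes (All.lookup p ρ∈) ¬fixed ∷ All.++⁻ʳ js q)

#-fixes-image : {σ τ : Permutation′ n} → σ # τ → ∀ i → Fixes σ i → Fixes σ (τ ⟨$⟩ʳ i)
#-fixes-image {σ = σ} {τ} p i σi≡i with p .fixes (τ ⟨$⟩ʳ i)
... | inj₁ q = q
... | inj₂ q = subst (Fixes σ) (sym (⟨$⟩ʳ-injective τ q)) σi≡i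

#-comm : {σ τ : Permutation′ n} → σ # τ → σ ∘ₚ τ ≈ τ ∘ₚ σ
#-comm {σ = σ} {τ} p i with p .fixes i
... | inj₁ q = trans (cong (τ ⟨$⟩ʳ_) q) (sym (#-fixes-image p i q))
... | inj₂ q = trans (#-fixes-image (#-sym p) i q) (cong (σ ⟨$⟩ʳ_) (sym q))

_#*_ : Permutation′ n → List (Permutation′ n) → Set
σ #* U = All (σ #_) U

-- Iterated differences and sensitivity

-- Integer values serve the counting of changes, rational values the polynomials. Since `_∘ₚ_`
-- applies its left factor first, `τ` acts on positions.
module Difference {A : Set} (_-_ : A → A → A) where
  D : Permutation′ n → (Permutation′ n → A) → Permutation′ n → A
  D τ h π = h (τ ∘ₚ π) - h π

  Δ : List (Permutation′ n) → (Permutation′ n → A) → Permutation′ n → A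
  Δ [] h = h
  Δ (σ ∷ σs) h = Δ σs (D σ h)

open Difference ℤ._-_

-- `U` collects the directions already differenced along; further directions must be disjoint from
-- these as well.
Vanish : ℕ → (Permutation′ n → ℤ) → List (Permutation′ n) → Set
Vanish d h U = ∀ σs → length σs ≡ d → AllPairs _#_ σs → All (_#* U) σs →
  ∀ π → Δ σs h π ≡ 0ℤ

Oscillation≤ : ℕ → (Permutation′ n → ℤ) → Set
Oscillation≤ R h = ∀ π ρ → h π ℤ.≤ h ρ ℤ.+ + R

D-oscillation : ∀ {R} {h : Permutation′ n → ℤ} τ →
  Oscillation≤ R h → Oscillation≤ (R ℕ.+ R) (D τ h)
D-oscillation {R = R} {h} τ osc π ρ = begin
  a ℤ.- b                            ≤⟨ ℤ.+-monoˡ-≤ (ℤ.- b) (osc (τ ∘ₚ π) (τ ∘ₚ ρ)) ⟩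
  (c ℤ.+ + R) ℤ.- b                  ≡⟨ eq₁ b c d (+ R) ⟩
  d ℤ.+ (c ℤ.- d ℤ.+ + R ℤ.- b)      ≤⟨ ℤ.+-monoˡ-≤ (c ℤ.- d ℤ.+ + R ℤ.- b) (osc ρ π) ⟩
  b ℤ.+ + R ℤ.+ (c ℤ.- d ℤ.+ + R ℤ.- b) ≡⟨ eq₂ b c d (+ R) ⟩
  (c ℤ.- d) ℤ.+ (+ R ℤ.+ + R)        ∎
  where
  open ℤ.≤-Reasoning
  a = h (τ ∘ₚ π)
  b = h π
  c = h (τ ∘ₚ ρ)
  d = h ρ
  open ℤSolver.+-*-Solver
  eq₁ : ∀ b c d r → (c ℤ.+ r) ℤ.- b ≡ d ℤ.+ (c ℤ.- d ℤ.+ r ℤ.- b)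
  eq₁ = solve 4 (λ b c d r → (c :+ r) :- b := d :+ (c :- d :+ r :- b)) refl
  eq₂ : ∀ b c d r → b ℤ.+ r ℤ.+ (c ℤ.- d ℤ.+ r ℤ.- b) ≡ (c ℤ.- d) ℤ.+ (r ℤ.+ r)
  eq₂ = solve 4 (λ b c d r → b :+ r :+ (c :- d :+ r :- b) := (c :- d) :+ (r :+ r)) refl

module _ {N R : ℕ} (h : Permutation′ n → ℤ) (U : List (Permutation′ n)) (π : Permutation′ n)
  (osc : Oscillation≤ R h)
  (few : ∀ τ → τ #* U → ∀ σs → AllPairs _#_ σs → All (_#* (τ ∷ U)) σs →
         All (λ σ → D τ h (σ ∘ₚ π) ≢ D τ h π) σs → length σs ℕ.≤ N)
  where

  private
    -- If `σ` leaves `D τ h` unchanged at `π`, then `τ` raises `h` after `σ` by as much as before,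
    -- and the gain of `σ`, at least 1 for integers, is added to it.
    step : ∀ {c} τ σ → D τ h (σ ∘ₚ π) ≡ D τ h π → h π ℤ.< h (σ ∘ₚ π) →
           h π ℤ.+ + c ℤ.≤ h (τ ∘ₚ π) → h π ℤ.+ + suc c ℤ.≤ h ((τ ∘ₚ σ) ∘ₚ π)
    step {c} τ σ eq lt le = begin
      h π ℤ.+ + suc c                       ≡⟨ eq₁ (h π) (+ c) ⟩
      (ℤ.suc (h π)) ℤ.+ (h π ℤ.+ + c) ℤ.- h π
        ≤⟨ ℤ.+-monoˡ-≤ (ℤ.- h π) (ℤ.+-mono-≤ (ℤ.i<j⇒suc[i]≤j lt) le) ⟩
      h (σ ∘ₚ π) ℤ.+ h (τ ∘ₚ π) ℤ.- h π     ≡⟨ eq₂ (h (σ ∘ₚ π)) (h (τ ∘ₚ π)) (h π) ⟩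
      D τ h π ℤ.+ h (σ ∘ₚ π)                ≡⟨ cong (ℤ._+ h (σ ∘ₚ π)) (sym eq) ⟩
      D τ h (σ ∘ₚ π) ℤ.+ h (σ ∘ₚ π)         ≡⟨ eq₃ (h (τ ∘ₚ σ ∘ₚ π)) (h (σ ∘ₚ π)) ⟩
      h (τ ∘ₚ σ ∘ₚ π)                       ∎
      where
      open ℤ.≤-Reasoning
      open ℤSolver.+-*-Solver
      eq₁ : ∀ a c → a ℤ.+ (1ℤ ℤ.+ c) ≡ (1ℤ ℤ.+ a) ℤ.+ (a ℤ.+ c) ℤ.- a
      eq₁ = solve 2 (λ a c → a :+ (con 1ℤ :+ c) := (con 1ℤ :+ a) :+ (a :+ c) :- a) refl
      eq₂ : ∀ a b c → a ℤ.+ b ℤ.- c ≡ (b ℤ.- c) ℤ.+ a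
      eq₂ = solve 3 (λ a b c → a :+ b :- c := (b :- c) :+ a) refl
      eq₃ : ∀ a b → (a ℤ.- b) ℤ.+ b ≡ a
      eq₃ = solve 2 (λ a b → (a :- b) :+ b := a) refl

  -- τ is the product of the c permutations chosen so far.  An increase by R + 1 being impossible, at most R + 1
  -- are ever chosen, and each choice skips at most N permutations to which D τ h is sensitive.
  greedy : ∀ s c → s ℕ.+ c ≡ suc R → ∀ τ σs → τ #* U → AllPairs _#_ σs →
           All (_#* (τ ∷ U)) σs → All (λ σ → h π ℤ.< h (σ ∘ₚ π)) σs →
           h π ℤ.+ + c ℤ.≤ h (τ ∘ₚ π) → length σs ℕ.≤ s ℕ.* suc N
  greedy zero .(suc R) refl τ σs _ _ _ _ le =
    contradiction (ℤ.≤-trans le (osc (τ ∘ₚ π) π))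
      (ℤ.<⇒≱ (ℤ.+-monoʳ-< (h π) (ℤ.+<+ (ℕ.n<1+n R))))
  greedy (suc s) c eq τ σs τU pw av up le
    with all-or-split (λ σ → ¬? (D τ h (σ ∘ₚ π) ℤ.≟ D τ h π)) σs
  ... | inj₁ bad = ℕ.≤-trans (few τ τU σs pw av bad)
                     (ℕ.≤-trans (ℕ.n≤1+n N) (ℕ.m≤m+n (suc N) (s ℕ.* suc N)))
  ... | inj₂ (xs , σ , ys , refl , bad , ¬bad) = begin
    length (xs ++ σ ∷ ys)          ≡⟨ length-++ xs ⟩
    length xs ℕ.+ suc (length ys)  ≡⟨ ℕ.+-suc (length xs) (length ys) ⟩
    suc (length xs ℕ.+ length ys)  ≤⟨ ℕ.s≤s (ℕ.+-mono-≤ xs-few ys-few) ⟩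
    suc (N ℕ.+ s ℕ.* suc N)        ∎
    where
    open ℕ.≤-Reasoning
    good = decidable-stable (D τ h (σ ∘ₚ π) ℤ.≟ D τ h π) ¬bad
    pw-xs = proj₁ (AllPairs-++⁻ xs pw)
    pw-σys = proj₂ (AllPairs-++⁻ xs pw)
    av-σys = All.++⁻ʳ xs av
    up-σys = All.++⁻ʳ xs up
    xs-few = few τ τU xs pw-xs (All.++⁻ˡ xs av) bad
    extend : ∀ {ys} → σ #* (τ ∷ U) → All (σ #_) ys → All (_#* (τ ∷ U)) ys → All (_#* (τ ∘ₚ σ ∷ U)) ys
    extend a [] [] = []
    extend a (p ∷ ps) (q ∷ qs) =
      (#-sym (#-∘ₚ (#-sym (All.head q)) p) ∷ All.tail q) ∷ extend a ps qs
    ys-few = greedy s (suc c) (trans (ℕ.+-suc s c) eq) (τ ∘ₚ σ) ys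
      (All.zipWith (λ (p , q) → #-∘ₚ p q) (τU , All.tail (All.head av-σys)))
      (AllPairs.tail pw-σys)
      (extend (All.head av-σys) (AllPairs.head pw-σys) (All.tail av-σys))
      (All.tail up-σys)
      (step τ σ good (All.head up-σys) le)

-- D τ doubles the oscillation; the two summands are for the σ that increase h and those that decrease it.
sensitivityBound : ℕ → ℕ → ℕ
sensitivityBound zero R = 0
sensitivityBound (suc d) R =
  suc R ℕ.* suc (sensitivityBound d (R ℕ.+ R)) ℕ.+ suc R ℕ.* suc (sensitivityBound d (R ℕ.+ R))

Vanish-D : ∀ {d} {h : Permutation′ n → ℤ} {U} τ → τ #* U →
           Vanish (suc d) h U → Vanish d (D τ h) (τ ∷ U)
Vanish-D τ τU v σs len pw av =
  v (τ ∷ σs) (cong suc len)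
    (All.map (#-sym ∘ All.head) av ∷ pw)
    (τU ∷ All.map All.tail av)

-- Increases and decreases might cancel, so each kind is bounded by itself, the decreases as
-- increases of `h⁻`. The induction hypothesis for `D τ h` is what `greedy` needs for every `τ`.
sensitivity≤ : ∀ d R {h : Permutation′ n → ℤ} {U} → Vanish d h U → Oscillation≤ R h →
  ∀ π σs → AllPairs _#_ σs → All (_#* U) σs →
  All (λ σ → h (σ ∘ₚ π) ≢ h π) σs → length σs ℕ.≤ sensitivityBound d R
sensitivity≤ zero R v osc π [] _ _ _ = ℕ.z≤n
-- With no directions, `Vanish` says that `h` itself is zero.
sensitivity≤ zero R v osc π (σ ∷ _) _ _ (p ∷ _) =
  contradiction (trans (v [] refl [] [] (σ ∘ₚ π)) (sym (v [] refl [] [] π))) p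
sensitivity≤ {n = n} (suc d) R {h} {U} v osc π σs pw av sens = begin
  length σs                              ≡⟨ length-filter-split up? σs ⟩
  length (filter up? σs) ℕ.+ length (filter (¬? ∘ up?) σs)
                                         ≤⟨ ℕ.+-mono-≤ ups downs ⟩
  sensitivityBound (suc d) R             ∎
  where
  open ℕ.≤-Reasoning
  up? : Decidable (λ σ → h π ℤ.< h (σ ∘ₚ π))
  up? σ = h π ℤ.<? h (σ ∘ₚ π)
  h⁻ : Permutation′ n → ℤ
  h⁻ ρ = ℤ.- h ρ
  few : ∀ τ → τ #* U → ∀ ρs → AllPairs _#_ ρs → All (_#* (τ ∷ U)) ρs →
        All (λ σ → D τ h (σ ∘ₚ π) ≢ D τ h π) ρs → length ρs ℕ.≤ sensitivityBound d (R ℕ.+ R)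
  few τ τU ρs = sensitivity≤ d (R ℕ.+ R) (Vanish-D τ τU v) (D-oscillation τ osc) π ρs
  D-neg : ∀ τ ρ → D τ h⁻ ρ ≡ ℤ.- D τ h ρ
  D-neg τ ρ = sym (ℤ.neg-distrib-+ (h (τ ∘ₚ ρ)) (ℤ.- h ρ))
  few⁻ : ∀ τ → τ #* U → ∀ ρs → AllPairs _#_ ρs → All (_#* (τ ∷ U)) ρs →
        All (λ σ → D τ h⁻ (σ ∘ₚ π) ≢ D τ h⁻ π) ρs → length ρs ℕ.≤ sensitivityBound d (R ℕ.+ R)
  few⁻ τ τU ρs pw av bad = few τ τU ρs pw av
    (All.map (λ {σ} p q → p (trans (D-neg τ (σ ∘ₚ π)) (trans (cong ℤ.-_ q) (sym (D-neg τ π))))) bad)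
  osc⁻ : Oscillation≤ R h⁻
  osc⁻ ρ ρ′ = subst₂ ℤ._≤_ (eq₁ (h ρ) (h ρ′)) (eq₂ (h ρ) (h ρ′) (+ R))
    (ℤ.+-monoˡ-≤ (ℤ.- h ρ ℤ.- h ρ′) (osc ρ′ ρ))
    where
    open ℤSolver.+-*-Solver
    eq₁ : ∀ a b → b ℤ.+ (ℤ.- a ℤ.- b) ≡ ℤ.- a
    eq₁ = solve 2 (λ a b → b :+ (:- a :- b) := :- a) refl
    eq₂ : ∀ a b r → a ℤ.+ r ℤ.+ (ℤ.- a ℤ.- b) ≡ ℤ.- b ℤ.+ r
    eq₂ = solve 3 (λ a b r → a :+ r :+ (:- a :- b) := :- b :+ r) refl
  weaken : ∀ {ρs} → All (_#* U) ρs → All (_#* (id ∷ U)) ρs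
  weaken = All.map (#-sym id-# ∷_)
  stay : ∀ g → g π ℤ.+ + 0 ℤ.≤ g (id ∘ₚ π)
  stay g = ℤ.≤-reflexive (ℤ.+-identityʳ (g π))
  decrease : ∀ {ρs} → All (λ σ → h (σ ∘ₚ π) ≢ h π) ρs → All (λ σ → ¬ h π ℤ.< h (σ ∘ₚ π)) ρs →
           All (λ σ → h⁻ π ℤ.< h⁻ (σ ∘ₚ π)) ρs
  decrease [] [] = []
  decrease (p ∷ ps) (q ∷ qs) =
    ℤ.neg-mono-< (ℤ.≤∧≢⇒< (ℤ.≮⇒≥ q) p) ∷ decrease ps qs
  ups = greedy h U π osc few (suc R) 0 (ℕ.+-identityʳ (suc R)) id (filter up? σs)
    (All.universal (λ _ → id-#) U) (AllPairs.filter⁺ up? pw) (weaken (All.filter⁺ up? av)) (All.all-filter up? σs) (stay h)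
  downs = greedy h⁻ U π osc⁻ few⁻ (suc R) 0 (ℕ.+-identityʳ (suc R)) id (filter (¬? ∘ up?) σs)
    (All.universal (λ _ → id-#) U) (AllPairs.filter⁺ (¬? ∘ up?) pw) (weaken (All.filter⁺ (¬? ∘ up?) av))
    (decrease (All.filter⁺ (¬? ∘ up?) sens) (All.all-filter (¬? ∘ up?) σs)) (stay h⁻)

-- Differences of polynomials

open Difference ℚ._-_ renaming (D to Dℚ; Δ to Δℚ)

-- Pointwise equal permutations need not be propositionally equal, so respect for `_≈_` is a
-- condition of its own.
Extensional : (Permutation′ n → ℚ) → Set
Extensional h = ∀ π ρ → π ≈ ρ → h π ≡ h ρ

Ignores : (Permutation′ n → ℚ) → Permutation′ n → Set
Ignores h σ = ∀ π → h (σ ∘ₚ π) ≡ h π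

Dℚ-extensional : {h : Permutation′ n → ℚ} → ∀ σ → Extensional h → Extensional (Dℚ σ h)
Dℚ-extensional σ ext π ρ eq = cong₂ ℚ._-_ (ext (σ ∘ₚ π) (σ ∘ₚ ρ) (eq ∘ (σ ⟨$⟩ʳ_))) (ext π ρ eq)

-- Disjoint permutations commute, so `ρ` can be moved past `σ` and then dropped.
Dℚ-ignores : {h : Permutation′ n → ℚ} {σ ρ : Permutation′ n} → Extensional h →
            σ # ρ → Ignores h ρ → Ignores (Dℚ σ h) ρ
Dℚ-ignores {σ = σ} {ρ} ext σ#ρ ig π = cong₂ ℚ._-_
  (trans (ext (σ ∘ₚ ρ ∘ₚ π) (ρ ∘ₚ σ ∘ₚ π) (cong (π ⟨$⟩ʳ_) ∘ #-comm σ#ρ)) (ig (σ ∘ₚ π))) (ig π)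

Δℚ-zero : {h : Permutation′ n → ℚ} → ∀ σs → (∀ π → h π ≡ 0ℚ) → ∀ π → Δℚ σs h π ≡ 0ℚ
Δℚ-zero [] z = z
Δℚ-zero (σ ∷ σs) z = Δℚ-zero σs (λ π → cong₂ ℚ._-_ (z (σ ∘ₚ π)) (z π))

-- Invariance under `ρ` survives the differences taken before it; the one along `ρ` is then zero,
-- and so are all later ones.
Δℚ-ignored : {h : Permutation′ n → ℚ} → ∀ {σs ρ} → Extensional h → AllPairs _#_ σs →
            ρ ∈ σs → Ignores h ρ → ∀ π → Δℚ σs h π ≡ 0ℚ
Δℚ-ignored {h = h} {_ ∷ σs} ext _ (here refl) ig =
  Δℚ-zero σs (λ π → trans (cong (ℚ._- h π) (ig π)) (ℚ.+-inverseʳ (h π)))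
Δℚ-ignored {σs = σ ∷ _} ext (p ∷ pw) (there ρ∈) ig =
  Δℚ-ignored (Dℚ-extensional σ ext) pw ρ∈ (Dℚ-ignores ext (All.lookup p ρ∈) ig)

-- The sum is a pointwise hypothesis because the induction passes to `Dℚ σ h`, which is a sum only
-- pointwise.
Δℚ-+ : {h a b : Permutation′ n → ℚ} → ∀ σs → (∀ π → h π ≡ a π ℚ.+ b π) →
      ∀ π → Δℚ σs h π ≡ Δℚ σs a π ℚ.+ Δℚ σs b π
Δℚ-+ [] eq = eq
Δℚ-+ {a = a} {b} (σ ∷ σs) eq = Δℚ-+ σs λ π →
  trans (cong₂ ℚ._-_ (eq (σ ∘ₚ π)) (eq π)) (rearrange (a (σ ∘ₚ π)) (b (σ ∘ₚ π)) (a π) (b π))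
  where
  open ℚSolver.+-*-Solver
  rearrange : ∀ a b c d → (a ℚ.+ b) ℚ.- (c ℚ.+ d) ≡ (a ℚ.- c) ℚ.+ (b ℚ.- d)
  rearrange = solve 4 (λ a b c d → (a :+ b) :- (c :+ d) := (a :- c) :+ (b :- d)) refl

evalMonomial-local : ∀ (vars : Monomial n) N π ρ →
  All (λ i → π ⟨$⟩ʳ i ≡ ρ ⟨$⟩ʳ i) (map proj₁ vars) →
  seq (evalMonomial vars π) N ≡ seq (evalMonomial vars ρ) N
evalMonomial-local [] N π ρ [] = refl
evalMonomial-local ((i , j) ∷ vars) N π ρ (eq ∷ eqs) =
  cong₂ ℚ._*_ (cong (λ k → seq (𝟙 (does (k Fin.≟ j))) N) eq) (evalMonomial-local vars N π ρ eqs)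

-- Real coefficients enter through their `N`-th rational approximations, for which the vanishing is
-- already exact.
Δℚ-eval : ∀ {d} (p : Polynomial n) → Degree≤ d p → ∀ N σs → AllPairs _#_ σs → d ℕ.< length σs →
         ∀ π → Δℚ σs (λ ρ → seq (eval p ρ) N) π ≡ 0ℚ
Δℚ-eval [] [] N σs pw lt = Δℚ-zero σs (λ _ → refl)
Δℚ-eval ((c , vars) ∷ p) (deg ∷ degs) N σs pw lt π =
  trans (Δℚ-+ {h = λ ρ → seq (eval ((c , vars) ∷ p) ρ) N} {a = term} {b = λ ρ → seq (eval p ρ) N} σs (λ _ → refl) π)
    (cong₂ ℚ._+_
      (Δℚ-ignored {h = term} (λ π ρ eq → term-local π ρ (All.universal eq (map proj₁ vars))) pw ρ∈
        (λ ρ → term-local (proj₁ block ∘ₚ ρ) ρ (All.map (cong (ρ ⟨$⟩ʳ_)) fixed)) π)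
      (Δℚ-eval p degs N σs pw lt π))
  where
  term : Permutation′ _ → ℚ
  term ρ = seq c N ℚ.* seq (evalMonomial vars ρ) N
  term-local : ∀ π ρ → All (λ i → π ⟨$⟩ʳ i ≡ ρ ⟨$⟩ʳ i) (map proj₁ vars) → term π ≡ term ρ
  term-local π ρ eqs = cong (seq c N ℚ.*_) (evalMonomial-local vars N π ρ eqs)
  block = untouched σs (map proj₁ vars) pw
    (ℕ.≤-<-trans (ℕ.≤-trans (ℕ.≤-reflexive (length-map proj₁ vars)) deg) lt)
  ρ∈ = proj₁ (proj₂ block)
  fixed = proj₂ (proj₂ block)

-- Limits of rational sequences and the passage to integers.

infix 4 _⟶_

_⟶_ : (ℕ → ℚ) → ℚ → Set
u ⟶ q = ∀ ε → .{{Positive ε}} → ∃[ N ] (∀ m → N ℕ.≤ m → ∣ u m ℚ.- q ∣ ℚ.≤ ε)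

⟶-sub : ∀ u v p q → u ⟶ p → v ⟶ q → (λ m → u m ℚ.- v m) ⟶ p ℚ.- q
⟶-sub u v p q u⟶p v⟶q ε = N ℕ.⊔ M , λ m le → begin
  ∣ (u m ℚ.- v m) ℚ.- (p ℚ.- q) ∣          ≡⟨ cong ∣_∣ (rearrange (u m) (v m) p q) ⟩
  ∣ (u m ℚ.- p) ℚ.- (v m ℚ.- q) ∣          ≤⟨ ℚ.∣p-q∣≤∣p∣+∣q∣ (u m ℚ.- p) (v m ℚ.- q) ⟩
  ∣ u m ℚ.- p ∣ ℚ.+ ∣ v m ℚ.- q ∣
    ≤⟨ ℚ.+-mono-≤ (proj₂ uN m (ℕ.m⊔n≤o⇒m≤o N M le)) (proj₂ vM m (ℕ.m⊔n≤o⇒n≤o N M le)) ⟩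
  ½ ℚ.* ε ℚ.+ ½ ℚ.* ε                      ≡⟨ half+half ε ⟩
  ε                                        ∎
  where
  open ℚ.≤-Reasoning
  instance
    half-pos : Positive (½ ℚ.* ε)
    half-pos = ℚ.pos*pos⇒pos ½ ε
  uN = u⟶p (½ ℚ.* ε)
  vM = v⟶q (½ ℚ.* ε)
  N = proj₁ uN
  M = proj₁ vM
  open ℚSolver.+-*-Solver
  rearrange : ∀ a b c d → (a ℚ.- b) ℚ.- (c ℚ.- d) ≡ (a ℚ.- c) ℚ.- (b ℚ.- d)
  rearrange = solve 4 (λ a b c d → (a :- b) :- (c :- d) := (a :- c) :- (b :- d)) refl

Δℚ-⟶ : (u : ℕ → Permutation′ n → ℚ) (h : Permutation′ n → ℚ) → ∀ σs →
      (∀ π → (λ m → u m π) ⟶ h π) → ∀ π → (λ m → Δℚ σs (u m) π) ⟶ Δℚ σs h π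
Δℚ-⟶ u h [] lim = lim
Δℚ-⟶ u h (σ ∷ σs) lim = Δℚ-⟶ (λ m → Dℚ σ (u m)) (Dℚ σ h) σs
  (λ π → ⟶-sub (λ m → u m (σ ∘ₚ π)) (λ m → u m π) (h (σ ∘ₚ π)) (h π) (lim (σ ∘ₚ π)) (lim π))

-- For nonzero `q`, closeness within half of `∣ q ∣` would give that `∣ q ∣` is at most its own
-- half.
zero-⟶ : ∀ {u q} → (∀ m → u m ≡ 0ℚ) → u ⟶ q → q ≡ 0ℚ
zero-⟶ {u} {q} z lim with q ℚ.≟ 0ℚ
... | yes eq = eq
... | no q≢0 = contradiction (begin-strict
  ½ ℚ.* ∣ q ∣             <⟨ subst (½ ℚ.* ∣ q ∣ ℚ.<_) (half+half ∣ q ∣)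
                               (subst (ℚ._< ½ ℚ.* ∣ q ∣ ℚ.+ ½ ℚ.* ∣ q ∣) (ℚ.+-identityʳ _)
                                 (ℚ.+-monoʳ-< (½ ℚ.* ∣ q ∣) (ℚ.positive⁻¹ (½ ℚ.* ∣ q ∣)))) ⟩
  ∣ q ∣                   ≡⟨ sym (ℚ.∣-p∣≡∣p∣ q) ⟩
  ∣ ℚ.- q ∣               ≡⟨ cong ∣_∣ (sym (ℚ.+-identityˡ (ℚ.- q))) ⟩
  ∣ 0ℚ ℚ.- q ∣            ≡⟨ cong (λ x → ∣ x ℚ.- q ∣) (sym (z N)) ⟩
  ∣ u N ℚ.- q ∣           ≤⟨ proj₂ (lim (½ ℚ.* ∣ q ∣)) N ℕ.≤-refl ⟩
  ½ ℚ.* ∣ q ∣             ∎) (ℚ.<-irrefl refl)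
  where
  open ℚ.≤-Reasoning
  instance
    pos : Positive ∣ q ∣
    pos = ℚ.nonNeg∧nonZero⇒pos ∣ q ∣ {{ℚ.∣-∣-nonNeg q}} {{ℚ.≢-nonZero (q≢0 ∘ ℚ.∣p∣≡0⇒p≡0 q)}}
    half-pos : Positive (½ ℚ.* ∣ q ∣)
    half-pos = ℚ.pos*pos⇒pos ½ ∣ q ∣
  N = proj₁ (lim (½ ℚ.* ∣ q ∣))

ι : ℤ → ℚ
ι z = z ℚ./ 1

ι-injective : ∀ {a b} → ι a ≡ ι b → a ≡ b
ι-injective {a} {b} eq with ℚ.fromℚᵘ-injective {ℚᵘ.mkℚᵘ a 0} {ℚᵘ.mkℚᵘ b 0} eq
... | ℚᵘ.*≡* p = trans (sym (ℤ.*-identityʳ a)) (trans p (ℤ.*-identityʳ b))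

-- Rational arithmetic normalises fractions, so the identity is checked on unnormalised
-- representatives.
ι-sub : ∀ a b → ι (a ℤ.- b) ≡ ι a ℚ.- ι b
ι-sub a b = ℚ.toℚᵘ-injective (begin
  ℚ.toℚᵘ (ι (a ℤ.- b))                        ≈⟨ unι (a ℤ.- b) ⟩
  ℚᵘ.mkℚᵘ (a ℤ.- b) 0                         ≈⟨ ℚᵘ.≃-reflexive (cong (λ z → ℚᵘ.mkℚᵘ z 0)
                                                  (sym (cong₂ ℤ._+_ (ℤ.*-identityʳ a) (ℤ.*-identityʳ (ℤ.- b))))) ⟩
  ℚᵘ.mkℚᵘ a 0 ℚᵘ.- ℚᵘ.mkℚᵘ b 0                ≈⟨ ℚᵘ.+-cong (ℚᵘ.≃-sym (unι a)) (ℚᵘ.-‿cong (ℚᵘ.≃-sym (unι b))) ⟩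
  ℚ.toℚᵘ (ι a) ℚᵘ.- ℚ.toℚᵘ (ι b)              ≈⟨ ℚᵘ.+-congʳ (ℚ.toℚᵘ (ι a)) (ℚᵘ.≃-sym (ℚ.toℚᵘ-homo‿- (ι b))) ⟩
  ℚ.toℚᵘ (ι a) ℚᵘ.+ ℚ.toℚᵘ (ℚ.- ι b)          ≈⟨ ℚᵘ.≃-sym (ℚ.toℚᵘ-homo-+ (ι a) (ℚ.- ι b)) ⟩
  ℚ.toℚᵘ (ι a ℚ.- ι b)                        ∎)
  where
  open ℚᵘ.≃-Reasoning
  unι : ∀ z → ℚ.toℚᵘ (ι z) ℚᵘ.≃ ℚᵘ.mkℚᵘ z 0
  unι z = ℚ.toℚᵘ-fromℚᵘ (ℚᵘ.mkℚᵘ z 0)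

Δℚ-ι : {h : Permutation′ n → ℚ} {g : Permutation′ n → ℤ} → ∀ σs → (∀ π → h π ≡ ι (g π)) →
      ∀ π → Δℚ σs h π ≡ ι (Δ σs g π)
Δℚ-ι [] eq = eq
Δℚ-ι {g = g} (σ ∷ σs) eq = Δℚ-ι σs (λ π →
  trans (cong₂ ℚ._-_ (eq (σ ∘ₚ π)) (eq π)) (sym (ι-sub (g (σ ∘ₚ π)) (g π))))

indicator : Bool → ℤ
indicator b = if b then 1ℤ else 0ℤ

-- The differences of the approximations are all zero and converge to the difference of the
-- indicator, which is therefore zero.
degree-Vanish : ∀ {d} (f : Permutation′ n → Bool) → deg (λ π → 𝟙 (f π)) ≤ d →
                Vanish (suc d) (indicator ∘ f) []
degree-Vanish {d = d} f (p , degs , agree) σs len pw _ π =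
  ι-injective (trans (sym (Δℚ-ι σs (λ _ → refl) π))
    (zero-⟶ (λ m → Δℚ-eval p degs m σs pw (ℕ.≤-reflexive (sym len)) π)
      (Δℚ-⟶ (λ m ρ → seq (eval p ρ) m) (ι ∘ indicator ∘ f) σs lim π)))
  where
  constant : ∀ b m → seq (𝟙 b) m ≡ ι (indicator b)
  constant false m = refl
  constant true m = refl
  lim : ∀ ρ → (λ m → seq (eval p ρ) m) ⟶ ι (indicator (f ρ))
  lim ρ ε = let N , close = agree ρ ε in N , λ m le →
    subst (λ q → ∣ seq (eval p ρ) m ℚ.- q ∣ ℚ.≤ ε) (constant (f ρ) m) (close m le)

-- Certificates

length-filter-< : ∀ {a p q} {A : Set a} {P : Pred A p} {Q : Pred A q}
  (P? : Decidable P) (Q? : Decidable Q) → (∀ {x} → P x → Q x) →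
  ∀ {z} xs → z ∈ xs → Q z → ¬ P z → length (filter P? xs) ℕ.< length (filter Q? xs)
length-filter-< P? Q? sub {z} xs z∈ qz ¬pz = go xs z∈
  where
  go≤ : ∀ xs → length (filter P? xs) ℕ.≤ length (filter Q? xs)
  go≤ [] = ℕ.z≤n
  go≤ (x ∷ xs) with P? x | Q? x
  ... | yes p | yes _ = ℕ.s≤s (go≤ xs)
  ... | yes p | no ¬q = contradiction (sub p) ¬q
  ... | no _ | yes _ = ℕ.m≤n⇒m≤1+n (go≤ xs)
  ... | no _ | no _ = go≤ xs
  go : ∀ xs → z ∈ xs → length (filter P? xs) ℕ.< length (filter Q? xs)
  go (x ∷ xs) (here refl) with P? z | Q? z
  ... | yes p | _ = contradiction p ¬pz
  ... | no _ | yes _ = ℕ.s≤s (go≤ xs)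
  ... | no _ | no ¬q = contradiction qz ¬q
  go (x ∷ xs) (there z∈) with P? x | Q? x
  ... | yes p | yes _ = ℕ.s≤s (go xs z∈)
  ... | yes p | no ¬q = contradiction (sub p) ¬q
  ... | no _ | yes _ = ℕ.m≤n⇒m≤1+n (go xs z∈)
  ... | no _ | no _ = go xs z∈

-- Without repetitions, every element after the first failure of `P` satisfies `P`.
length-filter-1 : ∀ {a p} {A : Set a} {P : Pred A p} (P? : Decidable P) → ∀ xs →
  Unique xs → (∀ {x y} → ¬ P x → ¬ P y → x ≡ y) → length xs ℕ.≤ suc (length (filter P? xs))
length-filter-1 P? [] _ _ = ℕ.z≤n
length-filter-1 P? (x ∷ xs) (x∉ ∷ u) same with P? x
... | yes _ = ℕ.s≤s (length-filter-1 P? xs u same)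
... | no ¬p = ℕ.s≤s (ℕ.≤-reflexive (cong length (sym (filter-all P?
    (All.map (λ {y} x≢y → decidable-stable (P? y) (x≢y ∘ same ¬p)) x∉)))))

Unique-⊆-length : ∀ {a} {A : Set a} {xs ys : List A} → Unique xs →
  (∀ {x} → x ∈ xs → x ∈ ys) → length xs ℕ.≤ length ys
Unique-⊆-length [] sub = ℕ.z≤n
Unique-⊆-length {xs = x ∷ xs} (x∉ ∷ u) sub with ∈-∃++ (sub (here refl))
... | as , bs , refl = ℕ.≤-trans (ℕ.s≤s (Unique-⊆-length u sub′))
        (ℕ.≤-reflexive (sym (length-++-sucʳ as x bs)))
  where
  sub′ : ∀ {y} → y ∈ xs → y ∈ as ++ bs
  sub′ y∈ with ∈-++⁻ as (sub (there y∈))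
  ... | inj₁ p = ∈-++⁺ˡ p
  ... | inj₂ (here refl) = contradiction refl (All.lookup x∉ y∈)
  ... | inj₂ (there p) = ∈-++⁺ʳ as p

length-allFin : ∀ n → length (allFin n) ≡ n
length-allFin n = length-tabulate (λ i → i)

fresh : ∀ (is : List (Fin n)) → length is ℕ.< n → ∃[ j ] j ∉ is
fresh {n} is lt with Fin.any? (λ j → ¬? (Any.any? (j Fin.≟_) is))
... | yes p = p
... | no none = contradiction (Unique-⊆-length (Unique.allFin⁺ n)
    (λ {j} _ → decidable-stable (Any.any? (j Fin.≟_) is) (λ j∉ → none (j , j∉))))
    (ℕ.<⇒≱ (subst (length is ℕ.<_) (sym (length-allFin n)) lt))

-- Transpositions and supports.

transpose-fixes : ∀ {i j k : Fin n} → k ≢ i → k ≢ j → Fixes (transpose i j) k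
transpose-fixes {i = i} {j} {k} k≢i k≢j
  rewrite dec-false (k Fin.≟ i) k≢i | dec-false (k Fin.≟ j) k≢j = refl

transpose-left : ∀ (i j : Fin n) → transpose i j ⟨$⟩ʳ i ≡ j
transpose-left i j rewrite dec-true (i Fin.≟ i) refl = refl

transpose-right : ∀ (i j : Fin n) → transpose i j ⟨$⟩ʳ j ≡ i
transpose-right i j with j Fin.≟ i
... | yes eq = eq
... | no _ rewrite dec-true (j Fin.≟ j) refl = refl

endpoint? : ∀ (i j k : Fin n) → k ≡ i ⊎ k ≡ j ⊎ (k ≢ i × k ≢ j)
endpoint? i j k with k Fin.≟ i | k Fin.≟ j
... | yes eq | _ = inj₁ eq
... | no _ | yes eq = inj₂ (inj₁ eq)
... | no k≢i | no k≢j = inj₂ (inj₂ (k≢i , k≢j))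

transpose-# : ∀ {i j k l : Fin n} → k ≢ i → k ≢ j → l ≢ i → l ≢ j → transpose i j # transpose k l
transpose-# {i = i} {j} {k} {l} p q r s ._#_.fixes x with endpoint? k l x
... | inj₁ refl = inj₁ (transpose-fixes p q)
... | inj₂ (inj₁ refl) = inj₁ (transpose-fixes r s)
... | inj₂ (inj₂ (x≢k , x≢l)) = inj₂ (transpose-fixes x≢k x≢l)

support : Permutation′ n → List (Fin n)
support {n} σ = filter (¬? ∘ fixes? σ) (allFin n)

∉-support : ∀ (σ : Permutation′ n) {i} → i ∉ support σ → Fixes σ i
∉-support σ {i} i∉ = decidable-stable (fixes? σ i) (i∉ ∘ ∈-filter⁺ (¬? ∘ fixes? σ) (∈-allFin i))

-- Permutations are enumerated as pairs of mutually inverse functions, by their codes.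
any-permutation? : {P : Permutation′ n → Set} → (∀ {π ρ} → π ≈ ρ → P π → P ρ) → Decidable P → Dec (∃[ π ] P π)
any-permutation? {n} {P} resp P? with Fin.any? (λ c → Fin.any? (λ c′ → code? (finToFun c) (finToFun c′)))
  where
  Code : (to from : Fin n → Fin n) → Set
  Code to from = ∃[ π ] ((∀ i → π ⟨$⟩ʳ i ≡ to i) × (∀ i → π ⟨$⟩ˡ i ≡ from i) × P π)
  code? : ∀ to from → Dec (Code to from)
  code? to from with Fin.all? (λ i → to (from i) Fin.≟ i) | Fin.all? (λ i → from (to i) Fin.≟ i)
  ... | no ¬l | _ = no λ (π , t , f , _) → ¬l λ i →
          trans (sym (t (from i))) (trans (cong (π ⟨$⟩ʳ_) (sym (f i))) (inverseʳ π))
  ... | yes _ | no ¬r = no λ (π , t , f , _) → ¬r λ i →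
          trans (sym (f (to i))) (trans (cong (π ⟨$⟩ˡ_) (sym (t i))) (inverseˡ π))
  ... | yes l | yes r with P? (permutation to from l r)
  ...   | yes p = yes (permutation to from l r , (λ _ → refl) , (λ _ → refl) , p)
  ...   | no ¬p = no λ (π , t , f , p) → ¬p (resp t p)
... | yes (_ , _ , π , _ , _ , p) = yes (π , p)
... | no none = no λ (π , p) → none (funToFin (π ⟨$⟩ʳ_) , funToFin (π ⟨$⟩ˡ_) , π ,
        (λ i → sym (Fin.finToFun-funToFin (π ⟨$⟩ʳ_) i)) ,
        (λ i → sym (Fin.finToFun-funToFin (π ⟨$⟩ˡ_) i)) , p)

Agree : Permutation′ n → Permutation′ n → List (Fin n) → Set
Agree π ρ is = All (λ i → π ⟨$⟩ʳ i ≡ ρ ⟨$⟩ʳ i) is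

agree? : (π ρ : Permutation′ n) → Decidable (Agree π ρ)
agree? π ρ = All.all? (λ i → π ⟨$⟩ʳ i Fin.≟ ρ ⟨$⟩ʳ i)

module _ (σ : Permutation′ n) where
  -- The chord joins two consecutive points of a cycle of `σ`; in `chord a ∘ₚ σ` that cycle skips
  -- `σ ⟨$⟩ʳ a`.
  chord : Fin n → Permutation′ n
  chord a = transpose a (σ ⟨$⟩ʳ a)

  chord-fixes : ∀ {a i} → ¬ Fixes σ a → Fixes σ i → Fixes (chord a) i
  chord-fixes {a} {i} ¬fix fix = transpose-fixes
    (λ { refl → ¬fix fix })
    (λ { refl → ¬fix (⟨$⟩ʳ-injective σ fix) })

  chord-∘ₚ-fixes : ∀ {a i} → ¬ Fixes σ a → Fixes σ i → Fixes (chord a ∘ₚ σ) i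
  chord-∘ₚ-fixes ¬fix fix = trans (cong (σ ⟨$⟩ʳ_) (chord-fixes ¬fix fix)) fix

  -- The point `σ ⟨$⟩ʳ a`, moved by `σ`, becomes fixed, and no fixed point of `σ` is lost.
  chord-∘ₚ-support : ∀ {a} → ¬ Fixes σ a → length (support (chord a ∘ₚ σ)) ℕ.< length (support σ)
  chord-∘ₚ-support {a} ¬fix = length-filter-< (¬? ∘ fixes? (chord a ∘ₚ σ)) (¬? ∘ fixes? σ)
    (λ ¬f f → ¬f (chord-∘ₚ-fixes ¬fix f)) (allFin n) (∈-allFin (σ ⟨$⟩ʳ a))
    (λ f → ¬fix (⟨$⟩ʳ-injective σ f))
    (λ ¬f → ¬f (cong (σ ⟨$⟩ʳ_) (transpose-right a (σ ⟨$⟩ʳ a))))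

  -- The choice of a excludes a, σ a and the preimage of a under σ, hence the factor 3.
  disjoint-chords : ∀ m is → Unique is → All (¬_ ∘ Fixes σ) is → m ℕ.* 3 ℕ.≤ length is →
    ∃[ as ] (length as ≡ m × All (¬_ ∘ Fixes σ) as × All (_∈ is) as × AllPairs (λ a b → chord a # chord b) as)
  disjoint-chords zero is _ _ _ = [] , refl , [] , [] , []
  disjoint-chords (suc m) (a ∷ is) (a∉ ∷ u) (¬fix ∷ moved) (ℕ.s≤s le) =
    let as , len , mv , as⊆ , pw = disjoint-chords m js
          (Unique.filter⁺ P? (Unique.filter⁺ Q? u)) (All.filter⁺ P? (All.filter⁺ Q? moved)) le′
    in a ∷ as , cong suc len , ¬fix ∷ mv , here refl ∷ All.map (there ∘ js⊆) as⊆ ,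
       All.map separate as⊆ ∷ pw
    where
    P? : Decidable (λ b → b ≢ σ ⟨$⟩ʳ a)
    P? b = ¬? (b Fin.≟ σ ⟨$⟩ʳ a)
    Q? : Decidable (λ b → σ ⟨$⟩ʳ b ≢ a)
    Q? b = ¬? (σ ⟨$⟩ʳ b Fin.≟ a)
    js = filter P? (filter Q? is)
    js⊆ : ∀ {b} → b ∈ js → b ∈ is
    js⊆ = proj₁ ∘ ∈-filter⁻ Q? ∘ proj₁ ∘ ∈-filter⁻ P?
    separate : ∀ {b} → b ∈ js → chord a # chord b
    separate {b} b∈ = transpose-# b≢a (proj₂ (∈-filter⁻ P? {xs = filter Q? is} b∈))
      (proj₂ (∈-filter⁻ Q? {xs = is} (proj₁ (∈-filter⁻ P? b∈))))
      (b≢a ∘ ⟨$⟩ʳ-injective σ)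
      where b≢a = λ { refl → All.lookup a∉ (js⊆ b∈) refl }
    le′ : m ℕ.* 3 ℕ.≤ length js
    le′ = ℕ.s≤s⁻¹ (ℕ.s≤s⁻¹ (begin
      suc (suc (m ℕ.* 3))                ≤⟨ le ⟩
      length is                          ≤⟨ length-filter-1 Q? is u
        (λ p q → ⟨$⟩ʳ-injective σ (trans (decidable-stable (_ Fin.≟ _) p) (sym (decidable-stable (_ Fin.≟ _) q)))) ⟩
      suc (length (filter Q? is))        ≤⟨ ℕ.s≤s (length-filter-1 P? (filter Q? is) (Unique.filter⁺ Q? u)
        (λ p q → trans (decidable-stable (_ Fin.≟ _) p) (sym (decidable-stable (_ Fin.≟ _) q)))) ⟩
      suc (suc (length js))              ∎))
      where open ℕ.≤-Reasoning

-- A support of `blockSize k` points has `k + 1` disjoint chords, one more than can all be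
-- sensitive. A certificate is a union of at most `k + 1` supports no larger than this.
blockSize certificateSize : ℕ → ℕ
blockSize k = suc k ℕ.* 3
certificateSize k = suc k ℕ.* blockSize k

module Certificates (k : ℕ) (f : Permutation′ n → Bool) (f-ext : ∀ π ρ → π ≈ ρ → f π ≡ f ρ)
  (few : ∀ π σs → AllPairs _#_ σs → All (λ σ → f (σ ∘ₚ π) ≢ f π) σs → length σs ℕ.≤ k) where

  -- If the support of σ is large, some chord of σ does not change f at σ ∘ₚ π, by the sensitivity bound there,
  -- and multiplying by it shrinks the support; m bounds the number of such steps.
  shrink : ∀ m π σ → length (support σ) ℕ.≤ m → f (σ ∘ₚ π) ≢ f π →
    ∃[ τ ] (f (τ ∘ₚ π) ≢ f π × (∀ i → Fixes σ i → Fixes τ i) × length (support τ) ℕ.≤ blockSize k)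
  shrink m π σ le sens with length (support σ) ℕ.≤? blockSize k
  ... | yes small = σ , sens , (λ _ p → p) , small
  shrink zero π σ le sens | no large = contradiction (ℕ.≤-trans le ℕ.z≤n) large
  shrink (suc m) π σ le sens | no large =
    let as , len , moved , _ , pw = disjoint-chords σ (suc k) (support σ)
          (Unique.filter⁺ (¬? ∘ fixes? σ) (Unique.allFin⁺ n))
          (All.all-filter (¬? ∘ fixes? σ) (allFin n)) (ℕ.<⇒≤ (ℕ.≰⇒> large))
    in reduce as len moved pw
    where
    reduce : ∀ as → length as ≡ suc k → All (¬_ ∘ Fixes σ) as →
      AllPairs (λ a b → chord σ a # chord σ b) as → _
    reduce as len moved pw with all-or-split (λ a → ¬? (f (chord σ a ∘ₚ σ ∘ₚ π) Bool.≟ f (σ ∘ₚ π))) as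
    ... | inj₁ all = contradiction
          (few (σ ∘ₚ π) (map (chord σ) as) (AllPairs.map⁺ pw) (All.map⁺ all))
          (ℕ.<⇒≱ (ℕ.≤-reflexive (trans (sym len) (sym (length-map (chord σ) as)))))
    ... | inj₂ (bs , a , cs , refl , _ , ¬sens) =
      let ¬fix = All.head (All.++⁻ʳ bs moved)
          same = decidable-stable (f (chord σ a ∘ₚ σ ∘ₚ π) Bool.≟ f (σ ∘ₚ π)) ¬sens
          τ , τ-sens , τ-fixes , small = shrink m π (chord σ a ∘ₚ σ)
            (ℕ.s≤s⁻¹ (ℕ.≤-trans (chord-∘ₚ-support σ ¬fix) le)) (sens ∘ trans (sym same))
      in τ , τ-sens , (λ i → τ-fixes i ∘ chord-∘ₚ-fixes σ ¬fix) , small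

  Certificate : Permutation′ n → List (Fin n) → Set
  Certificate π is = ∀ ρ → Agree ρ π is → f ρ ≡ f π

  -- If the union of the supports is no certificate, some `ρ` agreeing with `π` there has another
  -- value of `f`. It yields a sensitive permutation fixing these supports, and shrinking keeps its
  -- fixed points. The number `m` counts the additions left before `few` is violated.
  extend : ∀ m π σs → m ℕ.+ length σs ≡ suc k → AllPairs _#_ σs → All (λ σ → f (σ ∘ₚ π) ≢ f π) σs →
    All (λ σ → length (support σ) ℕ.≤ blockSize k) σs →
    ∃[ is ] (Certificate π is × length is ℕ.≤ certificateSize k)
  extend zero π σs eq pw sens small = contradiction (few π σs pw sens) (ℕ.<⇒≱ (ℕ.≤-reflexive (sym eq)))
  extend (suc m) π σs eq pw sens small
    with any-permutation? {P = λ ρ → Agree ρ π (concatMap support σs) × f ρ ≢ f π}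
      (λ {ρ} {ρ′} e (ag , p) → All.map (trans (sym (e _))) ag , p ∘ trans (f-ext ρ ρ′ e))
      (λ ρ → agree? ρ π (concatMap support σs) ×-dec ¬? (f ρ Bool.≟ f π))
  ... | no none = concatMap support σs ,
        (λ ρ ag → decidable-stable (f ρ Bool.≟ f π) (λ p → none (ρ , ag , p))) ,
        ℕ.≤-trans (concat-length σs small) (ℕ.*-monoˡ-≤ (blockSize k)
          (ℕ.≤-trans (ℕ.m≤n+m (length σs) (suc m)) (ℕ.≤-reflexive eq)))
    where
    concat-length : ∀ σs → All (λ σ → length (support σ) ℕ.≤ blockSize k) σs →
      length (concatMap support σs) ℕ.≤ length σs ℕ.* blockSize k
    concat-length [] [] = ℕ.z≤n
    concat-length (σ ∷ σs) (le ∷ les) = ℕ.≤-trans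
      (ℕ.≤-reflexive (length-++ (support σ))) (ℕ.+-mono-≤ le (concat-length σs les))
  ... | yes (ρ , ag , differ) =
    let τ , τ-sens , τ-fixes , τ-small = shrink (length (support σ)) π σ ℕ.≤-refl
          (differ ∘ trans (f-ext ρ (σ ∘ₚ π) (λ i → sym (inverseʳ π))))
    in extend m π (τ ∷ σs) (trans (ℕ.+-suc m (length σs)) eq)
         (All.map (λ {υ} sup → disjoint λ i → separate τ υ τ-fixes sup i) (supports σs ag) ∷ pw)
         (τ-sens ∷ sens) (τ-small ∷ small)
    where
    -- Chosen so that `σ ∘ₚ π` is `ρ`; it fixes every position where `ρ` and `π` agree.
    σ = ρ ∘ₚ flip π
    σ-fixes : ∀ {i} → ρ ⟨$⟩ʳ i ≡ π ⟨$⟩ʳ i → Fixes σ i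
    σ-fixes e = trans (cong (π ⟨$⟩ˡ_) e) (inverseˡ π)
    supports : ∀ σs → Agree ρ π (concatMap support σs) → All (λ υ → Agree ρ π (support υ)) σs
    supports [] _ = []
    supports (υ ∷ υs) ag = All.++⁻ˡ (support υ) ag ∷ supports υs (All.++⁻ʳ (support υ) ag)
    separate : ∀ τ υ → (∀ i → Fixes σ i → Fixes τ i) → Agree ρ π (support υ) → ∀ i → Fixes τ i ⊎ Fixes υ i
    separate τ υ τ-fixes sup i with Any.any? (i Fin.≟_) (support υ)
    ... | yes i∈ = inj₁ (τ-fixes i (σ-fixes (All.lookup sup i∈)))
    ... | no i∉ = inj₂ (∉-support υ i∉)

  certificate : ∀ π → ∃[ is ] (Certificate π is × length is ℕ.≤ certificateSize k)
  certificate π = extend (suc k) π [] (ℕ.+-identityʳ (suc k)) [] [] []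

-- Conflicts with `ρ` are removed one by one: if `τ` and `ρ` agree at `x`, the values of `τ` at `x`
-- and at a fresh `j` outside `is` are swapped. By injectivity of `τ` and of `ρ` there is then no
-- agreement at `x` or `j`.
avoid : ∀ (is : List (Fin n)) (ρ π : Permutation′ n) → suc (length is) ℕ.< n →
  ∃[ τ ] (Agree τ π is × (∀ {i} → i ∉ is → τ ⟨$⟩ʳ i ≢ ρ ⟨$⟩ʳ i))
avoid {n} is ρ π lt =
  let τ , ag , av = go (allFin n) in τ , ag , λ {i} → av (∈-allFin i)
  where
  go : ∀ js → ∃[ τ ] (Agree τ π is × (∀ {i} → i ∈ js → i ∉ is → τ ⟨$⟩ʳ i ≢ ρ ⟨$⟩ʳ i))
  go [] = π , All.universal (λ _ → refl) is , λ ()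
  go (x ∷ js) with go js
  ... | τ , ag , av with Any.any? (x Fin.≟_) is | τ ⟨$⟩ʳ x Fin.≟ ρ ⟨$⟩ʳ x
  ...   | yes x∈ | _ = τ , ag , λ { (here refl) i∉ → contradiction x∈ i∉ ; (there i∈) → av i∈ }
  ...   | no _ | no τx≢ρx = τ , ag , λ { (here refl) _ → τx≢ρx ; (there i∈) → av i∈ }
  ...   | no x∉ | yes τx≡ρx = transpose x j ∘ₚ τ ,
          All.tabulate (λ {i} i∈ → trans (cong (τ ⟨$⟩ʳ_)
            (transpose-fixes (λ { refl → x∉ i∈ }) (λ { refl → j∉ (there i∈) }))) (All.lookup ag i∈)) ,
          avoids
    where
    j = proj₁ (fresh (x ∷ is) lt)
    j∉ = proj₂ (fresh (x ∷ is) lt)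
    avoids : ∀ {i} → i ∈ x ∷ js → i ∉ is → τ ⟨$⟩ʳ (transpose x j ⟨$⟩ʳ i) ≢ ρ ⟨$⟩ʳ i
    avoids {i} i∈ i∉ eq with endpoint? x j i
    ... | inj₁ refl = j∉ (here (⟨$⟩ʳ-injective τ
            (trans (cong (τ ⟨$⟩ʳ_) (sym (transpose-left x j))) (trans eq (sym τx≡ρx)))))
    ... | inj₂ (inj₁ refl) = j∉ (here (⟨$⟩ʳ-injective ρ (trans (sym eq)
            (trans (cong (τ ⟨$⟩ʳ_) (transpose-right x j)) τx≡ρx))))
    ... | inj₂ (inj₂ (i≢x , i≢j)) with i∈
    ...   | here refl = i≢x refl
    ...   | there i∈js = av i∈js i∉ (trans (cong (τ ⟨$⟩ʳ_) (sym (transpose-fixes i≢x i≢j))) eq)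

-- Covering by stars

-- A union bound. `D` and `Q` pass to sublists, so the bound on each class may rely on them.
cover : ∀ {A C : Set} {D : A → A → Set} {Q : A → Set} {R : C → A → Set} (R? : ∀ c → Decidable (R c)) b cs xs →
  AllPairs D xs → All Q xs → All (λ x → Any (λ c → R c x) cs) xs →
  (∀ {c} → c ∈ cs → ∀ ys → AllPairs D ys → All Q ys → All (R c) ys → length ys ℕ.≤ b) →
  length xs ℕ.≤ length cs ℕ.* b
cover R? b [] [] _ _ _ _ = ℕ.z≤n
cover R? b [] (x ∷ xs) _ _ (() ∷ _) _
cover {R = R} R? b (c ∷ cs) xs pw qs covered bound = begin
  length xs                                             ≡⟨ length-filter-split (R? c) xs ⟩
  length (filter (R? c) xs) ℕ.+ length (filter (¬? ∘ R? c) xs)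
    ≤⟨ ℕ.+-mono-≤
         (bound (here refl) (filter (R? c) xs) (AllPairs.filter⁺ (R? c) pw) (All.filter⁺ (R? c) qs) (All.all-filter (R? c) xs))
         (cover R? b cs (filter (¬? ∘ R? c) xs) (AllPairs.filter⁺ (¬? ∘ R? c) pw) (All.filter⁺ (¬? ∘ R? c) qs)
           (All.zipWith other (All.all-filter (¬? ∘ R? c) xs , All.filter⁺ (¬? ∘ R? c) covered)) (bound ∘ there)) ⟩
  b ℕ.+ length cs ℕ.* b                                 ∎
  where
  open ℕ.≤-Reasoning
  other : ∀ {x} → ¬ R c x × Any (λ c → R c x) (c ∷ cs) → Any (λ c → R c x) cs
  other (¬r , here r) = contradiction r ¬r
  other (_ , there p) = p

-- Counting permutations with prescribed values.

Distinct : List (Permutation′ n) → Set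
Distinct = AllPairs (λ π ρ → ¬ π ≈ ρ)

Extends : Permutation′ n → List (Fin n × Fin n) → Set
Extends π = All (λ (i , j) → π ⟨$⟩ʳ i ≡ j)

Extends-unique : ∀ (π ρ : Permutation′ n) {S i} → Extends π S → Extends ρ S →
  i ∈ map proj₁ S → π ⟨$⟩ʳ i ≡ ρ ⟨$⟩ʳ i
Extends-unique π ρ {_ ∷ _} (p ∷ _) (q ∷ _) (here refl) = trans p (sym q)
Extends-unique π ρ {_ ∷ _} (_ ∷ ps) (_ ∷ qs) (there i∈) = Extends-unique π ρ ps qs i∈

!-suc : ∀ m → m ! ℕ.≤ suc m !
!-suc m = ℕ.m≤m+n (m !) (m ℕ.* m !)

!-mono-≤ : ∀ {m k} → m ℕ.≤ k → m ! ℕ.≤ k !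
!-mono-≤ {k = zero} ℕ.z≤n = ℕ.≤-refl
!-mono-≤ {m} {suc k} le with ℕ.m≤n⇒m<n∨m≡n le
... | inj₁ lt = ℕ.≤-trans (!-mono-≤ (ℕ.s≤s⁻¹ lt)) (!-suc k)
... | inj₂ refl = ℕ.≤-refl

-- With one extension `π` fixed, every extension sends a free `x` to the image under `π` of a listed
-- position, because the values on `S` are taken. Each such choice adds `x` and its value to `S`.
count-extensions : ∀ is S (πs : List (Permutation′ n)) → (∀ i → i ∈ map proj₁ S ⊎ i ∈ is) →
  Distinct πs → All (λ π → Extends π S) πs → length πs ℕ.≤ length is !
count-extensions is S [] _ _ _ = ℕ.z≤n
count-extensions [] S (_ ∷ []) _ _ _ = ℕ.≤-refl
count-extensions [] S (π ∷ ρ ∷ _) total ((π≉ρ ∷ _) ∷ _) (p ∷ q ∷ _) =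
  contradiction (λ i → determined i (total i)) π≉ρ
  where
  determined : ∀ i → i ∈ map proj₁ S ⊎ i ∈ [] → π ⟨$⟩ʳ i ≡ ρ ⟨$⟩ʳ i
  determined i (inj₁ i∈) = Extends-unique π ρ p q i∈
count-extensions {n = n} (x ∷ is) S πs@(π ∷ _) total pw ext@(p ∷ _) with Any.any? (x Fin.≟_) (map proj₁ S)
... | yes x∈ = ℕ.≤-trans (count-extensions is S πs total′ pw ext) (!-suc (length is))
  where
  total′ : ∀ i → i ∈ map proj₁ S ⊎ i ∈ is
  total′ i with total i
  ... | inj₁ i∈ = inj₁ i∈
  ... | inj₂ (here refl) = inj₁ x∈
  ... | inj₂ (there i∈) = inj₂ i∈
... | no x∉ = cover (λ z ρ → ρ ⟨$⟩ʳ x Fin.≟ π ⟨$⟩ʳ z) (length is !) (x ∷ is) πs pw ext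
      (All.map (λ {ρ} → covered {ρ}) ext) bound
  where
  covered : ∀ {ρ} → Extends ρ S → Any (λ z → ρ ⟨$⟩ʳ x ≡ π ⟨$⟩ʳ z) (x ∷ is)
  covered {ρ} q with total (π ⟨$⟩ˡ (ρ ⟨$⟩ʳ x))
  ... | inj₂ z∈ = Any.map (λ { refl → sym (inverseʳ π) }) z∈
  -- If `z`, the position with `π z = ρ x`, were in the domain of `S`, then `ρ z = π z = ρ x` would
  -- force `z = x`.
  ... | inj₁ z∈ = contradiction (subst (_∈ map proj₁ S)
        (⟨$⟩ʳ-injective ρ (trans (Extends-unique ρ π q p z∈) (inverseʳ π))) z∈) x∉
  bound : ∀ {z} → z ∈ x ∷ is → ∀ ρs → Distinct ρs → All (λ ρ → Extends ρ S) ρs → All (λ ρ → ρ ⟨$⟩ʳ x ≡ π ⟨$⟩ʳ z) ρs →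
    length ρs ℕ.≤ length is !
  bound {z} _ ρs pw′ ext′ eqs = count-extensions is ((x , π ⟨$⟩ʳ z) ∷ S) ρs total′ pw′
      (All.zipWith (λ (e , q) → e ∷ q) (eqs , ext′))
    where
    total′ : ∀ i → i ∈ (x ∷ map proj₁ S) ⊎ i ∈ is
    total′ i with total i
    ... | inj₁ i∈ = inj₁ (there i∈)
    ... | inj₂ (here refl) = inj₁ (here refl)
    ... | inj₂ (there i∈) = inj₂ i∈

star-size : ∀ {t} (S : List (Fin n × Fin n)) πs → Unique (map proj₁ S) → length S ≡ suc t →
  Distinct πs → All (λ π → Extends π S) πs → length πs ℕ.≤ (n ℕ.∸ t ℕ.∸ 1) !
star-size {n} {t} S πs u len pw ext = ℕ.≤-trans
  (count-extensions (filter (¬? ∘ in?) (allFin n)) S πs total pw ext) (!-mono-≤ free)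
  where
  is = map proj₁ S
  in? : Decidable (_∈ is)
  in? i = Any.any? (i Fin.≟_) is
  total : ∀ i → i ∈ is ⊎ i ∈ filter (¬? ∘ in?) (allFin n)
  total i with in? i
  ... | yes i∈ = inj₁ i∈
  ... | no i∉ = inj₂ (∈-filter⁺ (¬? ∘ in?) (∈-allFin i) i∉)
  free : length (filter (¬? ∘ in?) (allFin n)) ℕ.≤ n ℕ.∸ t ℕ.∸ 1
  free = begin
    c                                   ≡⟨ sym (ℕ.m+n∸m≡n a c) ⟩
    (a ℕ.+ c) ℕ.∸ a                     ≡⟨ cong (ℕ._∸ a) (trans (sym (length-filter-split in? (allFin n))) (length-allFin n)) ⟩
    n ℕ.∸ a                             ≤⟨ ℕ.∸-monoʳ-≤ n (ℕ.≤-trans (ℕ.≤-reflexive (sym (trans (length-map proj₁ S) len)))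
                                             (Unique-⊆-length u (λ i∈ → ∈-filter⁺ in? (∈-allFin _) i∈))) ⟩
    n ℕ.∸ suc t                         ≡⟨ cong (n ℕ.∸_) (sym (ℕ.+-comm t 1)) ⟩
    n ℕ.∸ (t ℕ.+ 1)                     ≡⟨ sym (ℕ.∸-+-assoc n t 1) ⟩
    n ℕ.∸ t ℕ.∸ 1                       ∎
    where
    open ℕ.≤-Reasoning
    a = length (filter in? (allFin n))
    c = length (filter (¬? ∘ in?) (allFin n))

sublists : ∀ {A : Set} → List A → List (List A)
sublists [] = [] ∷ []
sublists (x ∷ xs) = map (x ∷_) (sublists xs) ++ sublists xs

length-sublists : ∀ {A : Set} (xs : List A) → length (sublists xs) ≡ 2 ℕ.^ length xs
length-sublists [] = refl
length-sublists (x ∷ xs) = trans (length-++ (map (x ∷_) (sublists xs)))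
  (cong₂ ℕ._+_ (trans (length-map (x ∷_) (sublists xs)) (length-sublists xs))
    (trans (length-sublists xs) (sym (ℕ.+-identityʳ _))))

∈-sublists : ∀ {A : Set} {xs ys : List A} → xs ⊆ ys → xs ∈ sublists ys
∈-sublists [] = here refl
∈-sublists {ys = y ∷ ys} (_ ∷ʳ s) = ∈-++⁺ʳ (map (y ∷_) (sublists ys)) (∈-sublists s)
∈-sublists {ys = y ∷ ys} (refl ∷ s) = ∈-++⁺ˡ (∈-map⁺ (y ∷_) (∈-sublists s))

lookup-injective : ∀ {A : Set} {xs : List A} → Unique xs → ∀ {i j} → lookup xs i ≡ lookup xs j → i ≡ j
lookup-injective (_ ∷ _) {zero} {zero} _ = refl
lookup-injective (x∉ ∷ _) {zero} {suc j} eq = contradiction eq (All.lookup x∉ (∈-lookup j))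
lookup-injective (x∉ ∷ _) {suc i} {zero} eq = contradiction (sym eq) (All.lookup x∉ (∈-lookup i))
lookup-injective (_ ∷ u) {suc i} {suc j} eq = cong suc (lookup-injective u eq)

containedInStar : ∀ (F : Family n) (π : Permutation′ n) is → Unique is →
  (∀ ρ → ρ ∈ₚ members F → Agree ρ π is) → ContainedInStar (length is) F
containedInStar F π is u agree =
  mk↣ {to = lookup is} (lookup-injective u) ,
  mk↣ {to = λ k → π ⟨$⟩ʳ lookup is k} (lookup-injective u ∘ ⟨$⟩ʳ-injective π) ,
  λ ρ ρ∈ k → All.lookup (agree ρ ρ∈) (∈-lookup k)

-- Intersecting families whose members have small certificates.

module Kernel (F : Family n) {t : ℕ} (intersecting : Intersecting t F) (C : ℕ) (C<n : suc C ℕ.< n)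
  (certificate : ∀ π → π ∈ₚ members F →
    ∃[ is ] (Unique is × length is ℕ.≤ C × (∀ ρ → Agree ρ π is → ρ ∈ₚ members F))) where

  common : Permutation′ n → Permutation′ n → List (Fin n) → List (Fin n)
  common π ρ = filter (λ i → ρ ⟨$⟩ʳ i Fin.≟ π ⟨$⟩ʳ i)

  -- Off its certificate `π` is altered to some `τ` disagreeing there with `ρ`. Still in the family,
  -- `τ` agrees with `ρ` at `t` positions, which lie in the certificate, where `τ` equals `π`.
  certificate-overlap : ∀ π ρ (π∈ : π ∈ₚ members F) → ρ ∈ₚ members F →
    t ℕ.≤ length (common π ρ (proj₁ (certificate π π∈)))
  certificate-overlap π ρ π∈ ρ∈ =
    let is , u , le , closed = certificate π π∈
        τ , τ≡π , τ≢ρ = avoid is ρ π (ℕ.≤-<-trans (ℕ.s≤s le) C<n)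
        inside : ∀ {i} → i ∈ agreements τ ρ → i ∈ common π ρ is
        inside {i} i∈ =
          let τi≡ρi = proj₂ (∈-filter⁻ (λ i → τ ⟨$⟩ʳ i Fin.≟ ρ ⟨$⟩ʳ i) {xs = allFin n} i∈)
              i∈is = decidable-stable (Any.any? (i Fin.≟_) is) (λ i∉ → τ≢ρ i∉ τi≡ρi)
          in ∈-filter⁺ (λ i → ρ ⟨$⟩ʳ i Fin.≟ π ⟨$⟩ʳ i) i∈is (trans (sym τi≡ρi) (All.lookup τ≡π i∈is))
    in ℕ.≤-trans (intersecting τ ρ (closed τ τ≡π) ρ∈)
         (Unique-⊆-length (Unique.filter⁺ (λ i → τ ⟨$⟩ʳ i Fin.≟ ρ ⟨$⟩ʳ i) (Unique.allFin⁺ n)) inside)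

  -- The conditions on `T` are part of the class, so that all sublists of a certificate can serve as
  -- indices.
  Class : Permutation′ n → List (Fin n) → Permutation′ n → Set
  Class π T ρ = length T ≡ t × Unique T × Agree ρ π T

  unique? : Decidable (Unique {A = Fin n})
  unique? = AllPairs.allPairs? (λ i j → ¬? (i Fin.≟ j))

  class? : ∀ π T → Decidable (Class π T)
  class? π T ρ = (length T ℕ.≟ t) ×-dec (unique? T ×-dec agree? ρ π T)

  bound : ℕ
  bound = (n ℕ.∸ t ℕ.∸ 1) !

  -- Otherwise `T` contains all agreements of `ρ` and `σ` on the certificate of `σ`, at least `t` of
  -- them, and also a position where `σ` differs from `π`, hence from `ρ`. These are more than `t`
  -- positions.
  class-covered : ∀ π σ ρ {T} (σ∈ : σ ∈ₚ members F) → ¬ Agree σ π T → Class π T ρ → ρ ∈ₚ members F →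
    Any (λ x → x ∉ T × ρ ⟨$⟩ʳ x ≡ σ ⟨$⟩ʳ x) (proj₁ (certificate σ σ∈))
  class-covered π σ ρ {T} σ∈ ¬agree (len , _ , ρ≡π) ρ∈
    with Any.any? (λ x → ¬? (Any.any? (x Fin.≟_) T) ×-dec (ρ ⟨$⟩ʳ x Fin.≟ σ ⟨$⟩ʳ x)) (proj₁ (certificate σ σ∈))
  ... | yes p = p
  ... | no none = contradiction
        (Unique-⊆-length (All.¬Any⇒All¬ E i∉E ∷ Unique.filter⁺ same? (proj₁ (proj₂ (certificate σ σ∈)))) E⊆T)
        (ℕ.<⇒≱ (ℕ.s≤s (ℕ.≤-trans (ℕ.≤-reflexive len) (certificate-overlap σ ρ σ∈ ρ∈))))
    where
    is = proj₁ (certificate σ σ∈)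
    same? : Decidable (λ i → ρ ⟨$⟩ʳ i ≡ σ ⟨$⟩ʳ i)
    same? i = ρ ⟨$⟩ʳ i Fin.≟ σ ⟨$⟩ʳ i
    E = common σ ρ is
    witness = find (All.¬All⇒Any¬ (λ i → σ ⟨$⟩ʳ i Fin.≟ π ⟨$⟩ʳ i) T ¬agree)
    i = proj₁ witness
    i∈T = proj₁ (proj₂ witness)
    i∉E : i ∉ E
    i∉E i∈E = proj₂ (proj₂ witness)
      (trans (sym (proj₂ (∈-filter⁻ same? {xs = is} i∈E))) (All.lookup ρ≡π i∈T))
    E⊆T : ∀ {x} → x ∈ i ∷ E → x ∈ T
    E⊆T (here refl) = i∈T
    E⊆T {x} (there x∈E) = let x∈is , eq = ∈-filter⁻ same? {xs = is} x∈E in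
      decidable-stable (Any.any? (x Fin.≟_) T) (λ x∉ → none (lose x∈is (x∉ , eq)))

  -- One member `σ` differing from `π` on `T` serves the whole class: each position of its
  -- certificate outside `T` gives one star.
  class-size : ∀ π {T} → ¬ All (λ ρ → Agree ρ π T) (members F) → length T ≡ t → Unique T →
    ∀ ρs → Distinct ρs → All (_∈ₚ members F) ρs → All (Class π T) ρs → length ρs ℕ.≤ C ℕ.* bound
  class-size π {T} ¬agree len u ρs pw in-F classes = ℕ.≤-trans
    (cover (λ x ρ → ¬? (Any.any? (x Fin.≟_) T) ×-dec (ρ ⟨$⟩ʳ x Fin.≟ σ ⟨$⟩ʳ x)) bound is ρs pw classes
      (All.zipWith (λ {ρ} (c , ρ∈) → class-covered π σ ρ σ∈ ¬agree-σ c ρ∈) (classes , in-F)) size)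
    (ℕ.*-monoˡ-≤ bound (proj₁ (proj₂ (proj₂ (certificate σ σ∈)))))
    where
    witness = find (All.¬All⇒Any¬ (λ ρ → agree? ρ π T) (members F) ¬agree)
    σ = proj₁ witness
    σ∈ : σ ∈ₚ members F
    σ∈ = Any.map (λ { refl _ → refl }) (proj₁ (proj₂ witness))
    ¬agree-σ = proj₂ (proj₂ witness)
    is = proj₁ (certificate σ σ∈)
    -- The values on `T` come from `π`, the additional one from `σ`.
    star : Fin n → List (Fin n × Fin n)
    star x = (x , σ ⟨$⟩ʳ x) ∷ map (λ i → i , π ⟨$⟩ʳ i) T
    firsts : ∀ T → map proj₁ (map (λ i → i , π ⟨$⟩ʳ i) T) ≡ T
    firsts [] = refl
    firsts (i ∷ T) = cong (i ∷_) (firsts T)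
    size : ∀ {x} → x ∈ is → ∀ τs → Distinct τs → All (Class π T) τs →
      All (λ τ → x ∉ T × τ ⟨$⟩ʳ x ≡ σ ⟨$⟩ʳ x) τs → length τs ℕ.≤ bound
    size _ [] _ _ _ = ℕ.z≤n
    size {x} _ τs@(_ ∷ _) pw cs ps@((x∉ , _) ∷ _) = star-size (star x) τs
      (subst (λ is → Unique (x ∷ is)) (sym (firsts T)) (All.¬Any⇒All¬ T x∉ ∷ u))
      (cong suc (trans (length-map _ T) len)) pw
      (All.zipWith (λ ((_ , _ , ag) , (_ , eq)) → eq ∷ All.map⁺ ag) (cs , ps))

  -- Either the whole family agrees with `π` on some `t` positions of its certificate, or every
  -- class has a member of the family outside it and is small.
  kernel-at : ∀ π → π ∈ₚ members F → ContainedInStar t F ⊎ card F ℕ.≤ 2 ℕ.^ C ℕ.* C ℕ.* bound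
  kernel-at π π∈ with Any.any? (λ T → ((length T ℕ.≟ t) ×-dec unique? T) ×-dec All.all? (λ ρ → agree? ρ π T) (members F))
                          (sublists (proj₁ (certificate π π∈)))
  ... | yes found =
    let T , _ , (len , u) , agree = find found
    in inj₁ (subst (λ t → ContainedInStar t F) len (containedInStar F π T u
         (λ ρ ρ∈ → let σ , σ∈ , ρ≈σ = find ρ∈ in
           All.map (trans (ρ≈σ _)) (All.lookup agree σ∈))))
  ... | no none = inj₂ (begin
    length (members F)
      ≤⟨ cover (class? π) (C ℕ.* bound) (sublists is) (members F) (unique F) in-F
           (All.map (λ {ρ} → covered {ρ}) in-F) size ⟩
    length (sublists is) ℕ.* (C ℕ.* bound)
      ≡⟨ cong (ℕ._* (C ℕ.* bound)) (length-sublists is) ⟩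
    2 ℕ.^ length is ℕ.* (C ℕ.* bound)
      ≤⟨ ℕ.*-monoˡ-≤ (C ℕ.* bound) (ℕ.^-monoʳ-≤ 2 (proj₁ (proj₂ (proj₂ (certificate π π∈))))) ⟩
    2 ℕ.^ C ℕ.* (C ℕ.* bound)
      ≡⟨ sym (ℕ.*-assoc (2 ℕ.^ C) C bound) ⟩
    2 ℕ.^ C ℕ.* C ℕ.* bound ∎)
    where
    open ℕ.≤-Reasoning
    is = proj₁ (certificate π π∈)
    in-F : All (_∈ₚ members F) (members F)
    in-F = All.tabulate (Any.map (λ { refl _ → refl }))
    covered : ∀ {ρ} → ρ ∈ₚ members F → Any (λ T → Class π T ρ) (sublists is)
    -- `T` consists of the first `t` positions of the certificate of `π` at which `ρ` agrees with
    -- `π`.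
    covered {ρ} ρ∈ = lose (∈-sublists (⊆-trans (take-⊆ t E) (filter-⊆ same? is)))
      (trans (length-take t E) (ℕ.m≤n⇒m⊓n≡m (certificate-overlap π ρ π∈ ρ∈)) ,
       Unique.take⁺ t (Unique.filter⁺ same? (proj₁ (proj₂ (certificate π π∈)))) ,
       All.take⁺ t (All.all-filter same? is))
      where
      same? : Decidable (λ i → ρ ⟨$⟩ʳ i ≡ π ⟨$⟩ʳ i)
      same? i = ρ ⟨$⟩ʳ i Fin.≟ π ⟨$⟩ʳ i
      E = common π ρ is
    size : ∀ {T} → T ∈ sublists is → ∀ ρs → Distinct ρs → All (_∈ₚ members F) ρs →
      All (Class π T) ρs → length ρs ℕ.≤ C ℕ.* bound
    size _ [] _ _ _ = ℕ.z≤n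
    size T∈ ρs@(_ ∷ _) pw in-F′ cs@((len , u , _) ∷ _) =
      class-size π (λ agree → none (lose T∈ ((len , u) , agree))) len u ρs pw in-F′ cs

  kernel : ContainedInStar t F ⊎ card F ℕ.≤ 2 ℕ.^ C ℕ.* C ℕ.* bound
  kernel = go (members F) refl
    where
    go : ∀ πs → members F ≡ πs → ContainedInStar t F ⊎ card F ℕ.≤ 2 ℕ.^ C ℕ.* C ℕ.* bound
    -- An empty family offers no `π` but satisfies the bound.
    go [] eq = inj₂ (ℕ.≤-trans (ℕ.≤-reflexive (cong length eq)) ℕ.z≤n)
    go (π ∷ _) eq = kernel-at π (subst (π ∈ₚ_) (sym eq) (here (λ _ → refl)))

-- Families of bounded degree.

indicator-injective : ∀ {a b} → indicator a ≡ indicator b → a ≡ b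
indicator-injective {false} {false} _ = refl
indicator-injective {true} {true} _ = refl

indicator-oscillation : (f : Permutation′ n → Bool) → Oscillation≤ 1 (indicator ∘ f)
indicator-oscillation f π ρ with f π | f ρ
... | false | false = ℤ.+≤+ ℕ.z≤n
... | false | true  = ℤ.+≤+ ℕ.z≤n
... | true  | false = ℤ.+≤+ ℕ.≤-refl
... | true  | true  = ℤ.+≤+ (ℕ.s≤s ℕ.z≤n)

does-true : ∀ {A : Set} (a? : Dec A) → does a? ≡ true → A
does-true (yes a) _ = a

degree-sensitivity≤ : ∀ {d} (f : Permutation′ n → Bool) → deg (λ π → 𝟙 (f π)) ≤ d → ∀ π σs →
  AllPairs _#_ σs → All (λ σ → f (σ ∘ₚ π) ≢ f π) σs → length σs ≤ sensitivityBound (suc d) 1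
degree-sensitivity≤ {d = d} f deg π σs pw sens =
  -- Degree `d` makes differences of order `d + 1` vanish, and an indicator oscillates by at most 1.
  sensitivity≤ (suc d) 1 (degree-Vanish f deg) (indicator-oscillation f) π σs pw
    (All.universal (λ _ → []) σs) (All.map (_∘ indicator-injective) sens)

family-certificate : ∀ {d} (F : Family n) → deg (characteristic F) ≤ d → ∀ π → π ∈ₚ members F →
  ∃[ is ] (Unique is × length is ≤ certificateSize (sensitivityBound (suc d) 1) ×
           (∀ ρ → Agree ρ π is → ρ ∈ₚ members F))
family-certificate {n} {d} F deg π π∈ =
  let is , certifies , small = certificate π
  in deduplicate Fin._≟_ is , deduplicate-! Fin._≟_ is , ℕ.≤-trans (length-deduplicate Fin._≟_ is) small ,
     λ ρ agree → does-true (ρ ∈? members F)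
       (trans (certifies ρ (All.tabulate (All.lookup agree ∘ ∈-deduplicate⁺ Fin._≟_)))
         (dec-true (π ∈? members F) π∈))
  where
  f : Permutation′ n → Bool
  f ρ = does (ρ ∈? members F)
  f-ext : ∀ ρ σ → ρ ≈ σ → f ρ ≡ f σ
  f-ext ρ σ ρ≈σ = does-⇔ (mk⇔ (Any.map λ p i → trans (sym (ρ≈σ i)) (p i))
    (Any.map λ p i → trans (ρ≈σ i) (p i))) (ρ ∈? members F) (σ ∈? members F)
  open Certificates (sensitivityBound (suc d) 1) f f-ext (degree-sensitivity≤ f deg)

theorem1p5 : ∀ (t d : ℕ) → 1 ≤ t →
    ∃[ n₀ ] ∃[ K ] (∀ (n : ℕ) → n₀ ≤ n → (F : Family n) →
    Intersecting t F → deg (characteristic F) ≤ d →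
    ContainedInStar t F ⊎ card F ≤ K * (n ∸ t ∸ 1) !)
-- From `C + 2` on, there is a position outside any certificate and one further given position, as
-- `avoid` requires. In the constant, `2 ℕ.^ C` bounds the choices of `T` and `C` those of the
-- additional position.
theorem1p5 t d _ = suc (suc C) , 2 ℕ.^ C * C , λ n le F intersecting deg →
    Kernel.kernel F intersecting C le (family-certificate F deg)
  where
  C = certificateSize (sensitivityBound (suc d) 1)
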